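{- For every real $d \ge 1$ there exists a constant $\varepsilon_d > 0$, depending only on $d$, such that the following holds. There is an algorithm which, given an $n$-vertex undirected graph $G=(V,E)$ of average degree at most $d$ together with an edge weight function $c : E \to \mathbb{R}_+$, finds a Hamiltonian cycle of $G$ of smallest total weight (or reports that $G$ has no Hamiltonian cycle) in $\mathcal{O}^\star(2^{(1-\varepsilon_d)n})$ time and exponential space.
   Context: Graphs are finite. The average degree of an $n$-vertex graph $G=(V,E)$ is $\frac1n\sum_{v\in V}\deg(v) = 2|E|/n$. The weight of a cycle is the sum of the weights $c(e)$ of its edges. The notation $\mathcal{O}^\star(\cdot)$ suppresses factors polynomial in the input size; arithmetic operations and comparisons on weights are performed in the usual way (e.g. at unit or polynomial cost). "Exponential space" means that the space used is not restricted to be polynomial. -}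

module Defs where

open import Level using (0ℓ)
open import Data.Bool using (Bool; true; false; T; if_then_else_)
open import Data.Fin using (Fin; zero; suc; toℕ)
open import Data.Integer using (+_; -[1+_])
open import Data.List using (List; []; _∷_; _∷ʳ_; map; allFin; filterᵇ; length)
open import Data.List.Membership.Propositional using (_∈_)
open import Data.List.Relation.Unary.Linked using (Linked)
open import Data.List.Relation.Unary.Unique.Propositional using (Unique)
open import Data.Nat as ℕ using (ℕ; zero; suc; NonZero)
open import Data.Nat.ListAction using (sum)
import Data.Nat.Properties as ℕₚ
open import Data.Product using (∃-syntax; _×_; _,_)
open import Data.Rational as ℚ using (ℚ; 0ℚ; 1ℚ; ½; ↥_; ↧ₙ_)
import Data.Rational.Properties as ℚₚ
open import Data.Rational.Solver using (module +-*-Solver)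
open import Data.Vec using (Vec; []; _∷_; lookup)
open import Relation.Binary using (Rel)
open import Relation.Binary.PropositionalEquality using (_≡_; refl; sym; trans; cong; subst)
open import Relation.Nullary using (¬_)

-- Real numbers: Cauchy sequences of rationals, equal when _≈ᴿ_.

record ℝ : Set where
  constructor mkℝ
  field
    seq    : ℕ → ℚ
    cauchy : ∀ ε → 0ℚ ℚ.< ε →
             ∃[ N ] (∀ m n → N ℕ.≤ m → N ℕ.≤ n → ℚ.∣ seq m ℚ.- seq n ∣ ℚ.≤ ε)

open ℝ public

infix 4 _≤ᴿ_ _<ᴿ_ _≈ᴿ_

_≤ᴿ_ : Rel ℝ 0ℓ
x ≤ᴿ y = ∀ ε → 0ℚ ℚ.< ε →
         ∃[ N ] (∀ n → N ℕ.≤ n → seq x n ℚ.≤ seq y n ℚ.+ ε)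

_<ᴿ_ : Rel ℝ 0ℓ
x <ᴿ y = ∃[ ε ] (0ℚ ℚ.< ε ×
         ∃[ N ] (∀ n → N ℕ.≤ n → seq x n ℚ.+ ε ℚ.≤ seq y n))

_≈ᴿ_ : Rel ℝ 0ℓ
x ≈ᴿ y = x ≤ᴿ y × y ≤ᴿ x

fromℚ : ℚ → ℝ
fromℚ q = mkℝ (λ _ → q) λ ε 0<ε → 0 , λ _ _ _ _ →
  subst (ℚ._≤ ε) (sym (cong ℚ.∣_∣ (ℚₚ.+-inverseʳ q))) (ℚₚ.<⇒≤ 0<ε)

0ᴿ 1ᴿ : ℝ
0ᴿ = fromℚ 0ℚ
1ᴿ = fromℚ 1ℚ

private
  0<half : ∀ {ε} → 0ℚ ℚ.< ε → 0ℚ ℚ.< ½ ℚ.* ε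
  0<half {ε} 0<ε =
    ℚₚ.positive⁻¹ (½ ℚ.* ε) {{ℚₚ.pos*pos⇒pos ½ ε {{ℚ.positive 0<ε}}}}

  half+half : ∀ ε → ½ ℚ.* ε ℚ.+ ½ ℚ.* ε ≡ ε
  half+half ε = trans (sym (ℚₚ.*-distribʳ-+ ε ½ ½)) (ℚₚ.*-identityˡ ε)

  interchange : ∀ a b c d →
    (a ℚ.+ b) ℚ.- (c ℚ.+ d) ≡ (a ℚ.- c) ℚ.+ (b ℚ.- d)
  interchange = solve 4
    (λ a b c d → (a :+ b) :- (c :+ d) := (a :- c) :+ (b :- d)) refl
    where open +-*-Solver

infixl 6 _+ᴿ_ _-ᴿ_
infix  8 -ᴿ_

_+ᴿ_ : ℝ → ℝ → ℝ
seq    (x +ᴿ y) n = seq x n ℚ.+ seq y n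
cauchy (x +ᴿ y) ε 0<ε
  with cauchy x (½ ℚ.* ε) (0<half 0<ε) | cauchy y (½ ℚ.* ε) (0<half 0<ε)
... | M , p | N , q = M ℕ.+ N , λ m n h k → begin
  ℚ.∣ (seq x m ℚ.+ seq y m) ℚ.- (seq x n ℚ.+ seq y n) ∣
    ≡⟨ cong ℚ.∣_∣ (interchange (seq x m) (seq y m) (seq x n) (seq y n)) ⟩
  ℚ.∣ (seq x m ℚ.- seq x n) ℚ.+ (seq y m ℚ.- seq y n) ∣
    ≤⟨ ℚₚ.∣p+q∣≤∣p∣+∣q∣ (seq x m ℚ.- seq x n) (seq y m ℚ.- seq y n) ⟩
  ℚ.∣ seq x m ℚ.- seq x n ∣ ℚ.+ ℚ.∣ seq y m ℚ.- seq y n ∣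
    ≤⟨ ℚₚ.+-mono-≤
         (p m n (ℕₚ.m+n≤o⇒m≤o M h) (ℕₚ.m+n≤o⇒m≤o M k))
         (q m n (ℕₚ.m+n≤o⇒n≤o M h) (ℕₚ.m+n≤o⇒n≤o M k)) ⟩
  ½ ℚ.* ε ℚ.+ ½ ℚ.* ε
    ≡⟨ half+half ε ⟩
  ε ∎
  where open ℚₚ.≤-Reasoning

-ᴿ_ : ℝ → ℝ
seq    (-ᴿ x) n = ℚ.- seq x n
cauchy (-ᴿ x) ε 0<ε with cauchy x ε 0<ε
... | N , p = N , λ m n h k →
  subst (ℚ._≤ ε)
    (trans (sym (ℚₚ.∣-p∣≡∣p∣ (seq x m ℚ.- seq x n)))
           (cong ℚ.∣_∣ (ℚₚ.neg-distrib-+ (seq x m) (ℚ.- seq x n))))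
    (p m n h k)

_-ᴿ_ : ℝ → ℝ → ℝ
x -ᴿ y = x +ᴿ (-ᴿ y)

infixl 7 _·ᴿ_

_·ᴿ_ : ℕ → ℝ → ℝ
zero  ·ᴿ x = 0ᴿ
suc n ·ᴿ x = x +ᴿ n ·ᴿ x

-- For r = p / q in lowest terms, t ≤ B · 2 ^ r is cleared of roots and of
-- negative exponents: t ^ q ≤ B ^ q · 2 ^ p.
_≤_·2^ℚ_ : ℕ → ℕ → ℚ → Set
t ≤ B ·2^ℚ r with ↥ r
... | + p      = t ℕ.^ ↧ₙ r ℕ.≤ B ℕ.^ ↧ₙ r ℕ.* 2 ℕ.^ p
... | -[1+ p ] = t ℕ.^ ↧ₙ r ℕ.* 2 ℕ.^ suc p ℕ.≤ B ℕ.^ ↧ₙ r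

-- 2 ^ x is the infimum of 2 ^ r over the rationals r ≥ x.
_≤_·2^_ : ℕ → ℕ → ℝ → Set
t ≤ B ·2^ x = ∀ r → x ≤ᴿ fromℚ r → t ≤ B ·2^ℚ r

record Graph (n : ℕ) : Set where
  field
    adj        : Fin n → Fin n → Bool
    adj-sym    : ∀ u v → adj u v ≡ adj v u
    adj-irrefl : ∀ v → adj v v ≡ false

  Adj : Rel (Fin n) 0ℓ
  Adj u v = T (adj u v)

  deg : Fin n → ℕ
  deg v = length (filterᵇ (adj v) (allFin n))

  averageDegree : .{{NonZero n}} → ℚ
  averageDegree = + sum (map deg (allFin n)) ℚ./ n

open Graph public

-- Only the values c u v at adjacent u, v are meaningful: neither the encoding
-- of the input nor the weight of a cycle involves any other value.
record EdgeWeights {n : ℕ} (G : Graph n) : Set where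
  field
    c        : Fin n → Fin n → ℝ
    c-sym    : ∀ u v → Adj G u v → c u v ≈ᴿ c v u
    c-nonneg : ∀ u v → Adj G u v → 0ᴿ ≤ᴿ c u v

open EdgeWeights public

closeUp : ∀ {A : Set} → List A → List A
closeUp []       = []
closeUp (v ∷ vs) = (v ∷ vs) ∷ʳ v

-- The list is the cyclic order in which the cycle visits the vertices.
record HamiltonianCycle {n : ℕ} (G : Graph n) (vs : List (Fin n)) : Set where
  field
    length≥3 : 3 ℕ.≤ length vs
    distinct : Unique vs
    covers   : ∀ v → v ∈ vs
    adjacent : Linked (Adj G) (closeUp vs)

walkWeight : ∀ {n} {G : Graph n} → EdgeWeights G → List (Fin n) → ℝ
walkWeight w []           = 0ᴿ
walkWeight w (u ∷ [])     = 0ᴿ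
walkWeight w (u ∷ v ∷ vs) = c w u v +ᴿ walkWeight w (v ∷ vs)

cycleWeight : ∀ {n} {G : Graph n} → EdgeWeights G → List (Fin n) → ℝ
cycleWeight w vs = walkWeight w (closeUp vs)

-- Algorithms: programs of a call-by-value functional language over
-- LISP-style data whose atoms are nil and real weights.  A program is one
-- finite term, independent of its input.  Weights are opaque: they can only
-- be added and compared, at unit cost.  The outcome of a comparison is the truth
-- value of x ≤ᴿ y; that every comparison has an outcome (Decidable _≤ᴿ_) holds
-- classically but not constructively.  There is no primitive integer
-- arithmetic, and there is no bound on space.
--
-- Every evaluation rule costs 1 and is a constant-time operation of an
-- environment machine with shared data.  Conversely, a balanced tree
-- simulates a random-access memory of size 2 ^ O(n) with overhead O(n) per
-- access, so running times O*(2 ^ (α n)) are the same as on a RAM.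

-- A term with m free variables (de Bruijn indices).
data Term (m : ℕ) : Set where
  var  : Fin m → Term m
  letT : Term m → Term (suc m) → Term m
  -- A recursive function: variable 0 is the argument, variable 1 the function
  -- itself.
  fun  : Term (suc (suc m)) → Term m
  app  : Term m → Term m → Term m
  nil  : Term m
  cons : Term m → Term m → Term m
  -- In the second branch variable 0 is the head and variable 1 the tail.
  case : Term m → Term m → Term (suc (suc m)) → Term m
  zeroW : Term m
  addW  : Term m → Term m → Term m
  -- ifLe a b s t: if a ≤ b then s else t.
  ifLe  : Term m → Term m → Term m → Term m → Term m

data Value : Set where
  nil     : Value
  cons    : Value → Value → Value
  weight  : ℝ → Value
  closure : ∀ {m} → Vec Value m → Term (suc (suc m)) → Value

-- ρ ⊢ e ⇓ v [ t ]: in environment ρ, e evaluates to v in t steps.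
infix 3 _⊢_⇓_[_]

data _⊢_⇓_[_] {m : ℕ} (ρ : Vec Value m) : Term m → Value → ℕ → Set where
  ⇓var : ∀ {i} →
    ρ ⊢ var i ⇓ lookup ρ i [ 1 ]
  ⇓let : ∀ {a b u v s t} →
    ρ ⊢ a ⇓ u [ s ] → u ∷ ρ ⊢ b ⇓ v [ t ] →
    ρ ⊢ letT a b ⇓ v [ suc (s ℕ.+ t) ]
  ⇓fun : ∀ {b} →
    ρ ⊢ fun b ⇓ closure ρ b [ 1 ]
  ⇓app : ∀ {f a k} {σ : Vec Value k} {b u v r s t} →
    ρ ⊢ f ⇓ closure σ b [ r ] → ρ ⊢ a ⇓ u [ s ] →
    u ∷ closure σ b ∷ σ ⊢ b ⇓ v [ t ] →
    ρ ⊢ app f a ⇓ v [ suc (r ℕ.+ s ℕ.+ t) ]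
  ⇓nil :
    ρ ⊢ nil ⇓ nil [ 1 ]
  ⇓cons : ∀ {a b u v s t} →
    ρ ⊢ a ⇓ u [ s ] → ρ ⊢ b ⇓ v [ t ] →
    ρ ⊢ cons a b ⇓ cons u v [ suc (s ℕ.+ t) ]
  ⇓case-nil : ∀ {a b b′ v s t} →
    ρ ⊢ a ⇓ nil [ s ] → ρ ⊢ b ⇓ v [ t ] →
    ρ ⊢ case a b b′ ⇓ v [ suc (s ℕ.+ t) ]
  ⇓case-cons : ∀ {a b b′ h l v s t} →
    ρ ⊢ a ⇓ cons h l [ s ] → h ∷ l ∷ ρ ⊢ b′ ⇓ v [ t ] →
    ρ ⊢ case a b b′ ⇓ v [ suc (s ℕ.+ t) ]
  ⇓zeroW :
    ρ ⊢ zeroW ⇓ weight 0ᴿ [ 1 ]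
  ⇓addW : ∀ {a b x y s t} →
    ρ ⊢ a ⇓ weight x [ s ] → ρ ⊢ b ⇓ weight y [ t ] →
    ρ ⊢ addW a b ⇓ weight (x +ᴿ y) [ suc (s ℕ.+ t) ]
  ⇓ifLe-yes : ∀ {a b p q x y v r s t} →
    ρ ⊢ a ⇓ weight x [ r ] → ρ ⊢ b ⇓ weight y [ s ] → x ≤ᴿ y →
    ρ ⊢ p ⇓ v [ t ] →
    ρ ⊢ ifLe a b p q ⇓ v [ suc (r ℕ.+ s ℕ.+ t) ]
  ⇓ifLe-no : ∀ {a b p q x y v r s t} →
    ρ ⊢ a ⇓ weight x [ r ] → ρ ⊢ b ⇓ weight y [ s ] → ¬ (x ≤ᴿ y) →
    ρ ⊢ q ⇓ v [ t ] →
    ρ ⊢ ifLe a b p q ⇓ v [ suc (r ℕ.+ s ℕ.+ t) ]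

-- The only free variable of a program is its input.
Program : Set
Program = Term 1

encodeList : ∀ {A : Set} → (A → Value) → List A → Value
encodeList f []       = nil
encodeList f (x ∷ xs) = cons (f x) (encodeList f xs)

encodeℕ : ℕ → Value
encodeℕ zero    = nil
encodeℕ (suc i) = cons nil (encodeℕ i)

-- The weighted adjacency matrix, as the list of its rows; a non-edge is nil.
encodeInstance : ∀ {n} (G : Graph n) → EdgeWeights G → Value
encodeInstance {n} G w = encodeList (λ u → encodeList (entry u) (allFin n)) (allFin n)
  where
  entry : Fin n → Fin n → Value
  entry u v = if adj G u v then cons (weight (c w u v)) nil else nil

-- The correct outputs.  A Hamiltonian cycle is a nonempty list, so its encoding
-- differs from the report nil.
data TSPAnswer {n : ℕ} (G : Graph n) (w : EdgeWeights G) : Value → Set where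
  noCycle : (∀ vs → ¬ HamiltonianCycle G vs) → TSPAnswer G w nil
  optimal : ∀ vs → HamiltonianCycle G vs →
            (∀ vs′ → HamiltonianCycle G vs′ → cycleWeight w vs ≤ᴿ cycleWeight w vs′) →
            TSPAnswer G w (encodeList (λ v → encodeℕ (toℕ v)) vs)

{-# OPTIONS --safe #-}
module Submission where

open import Defs
open import Data.Bool using (Bool; true; false; T; T?; if_then_else_; not; _∧_)
import Data.Bool.Properties as Boolₚ
open import Data.Bool.Properties using (T-≡)
open import Data.Fin using (Fin; zero; suc; toℕ)
import Data.Fin.Properties as Finₚ
open import Data.Integer as ℤ using (+_; -[1+_])
import Data.Integer.Properties as ℤₚ
import Data.Integer.Tactic.RingSolver as ℤSolver
open import Data.List
  using (List; []; _∷_; _++_; _∷ʳ_; map; length; filter; filterᵇ; concatMap; allFin; tabulate)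
import Data.List.Membership.DecPropositional as DecMembership
open import Data.List.Membership.Propositional using (_∈_; _∉_)
open import Data.List.Membership.Propositional.Properties
import Data.List.Properties as Listₚ
import Data.List.Relation.Binary.Permutation.Propositional.Properties as Perm
open import Data.List.Relation.Unary.All as All using (All; []; _∷_)
open import Data.List.Relation.Unary.AllPairs as AllPairs using (AllPairs; []; _∷_)
open import Data.List.Relation.Unary.Any as Any using (here; there)
open import Data.List.Relation.Unary.Any.Properties using (singleton⁻)
open import Data.List.Relation.Unary.Linked as Linked using (Linked; []; [-]; _∷_)
open import Data.List.Relation.Unary.Unique.Propositional as Unique using (Unique)
import Data.List.Relation.Unary.Unique.Propositional.Properties as Uniqueₚ
open import Data.Maybe using (Maybe; just; nothing)
open import Data.Maybe.Properties using (just-injective)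
open import Data.Nat hiding (_≟_)
open import Data.Nat.ListAction using (sum)
open import Data.Nat.ListAction.Properties using (sum-↭)
open import Data.Nat.Properties hiding (_≟_)
open import Data.Nat.Tactic.RingSolver using (solve-∀)
open import Data.Product using (Σ-syntax; ∃-syntax; ∃₂; _×_; _,_; proj₁; proj₂)
open import Data.Rational as ℚ using (ℚ; mkℚ; 0ℚ; 1ℚ; ½; toℚᵘ; ↥_)
import Data.Rational.Properties as ℚₚ
open import Data.Rational.Solver using (module +-*-Solver)
open import Data.Rational.Unnormalised as ℚᵘ using (mkℚᵘ; *≤*; *≡*)
import Data.Rational.Unnormalised.Properties as ℚᵘₚ
open import Data.Sum using (_⊎_; inj₁; inj₂)
open import Data.Unit using (⊤; tt)
open import Data.Vec as Vec using (Vec; []; _∷_; lookup; _[_]≔_)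
import Data.Vec.Properties as Vecₚ
open import Function using (_∘_; Equivalence)
open import Relation.Binary.Definitions using (Decidable)
open import Relation.Binary.PropositionalEquality
open import Relation.Nullary using (¬_; Dec; yes; no; contradiction; ¬?)

-- Dynamic programming over pairs (set of visited vertices, last vertex), as in Held–Karp,
-- restricted to the pairs that some path realises.  Tries keep only the lightest path for each
-- pair, so the time is polynomial times the number of vertex sets of paths.
--
-- That number is small because a set X that leaves many vertices isolated is not the vertex
-- set of a path.  Some dyadic threshold 2 ^ i, bounded in terms of d, has h ≪ n / 2 ^ i vertices
-- of degree at least 2 ^ i.  Ignoring those, the vertices of degree at most 2 d have small
-- neighbourhoods, and a constant times n / 2 ^ i of them have disjoint closed neighbourhoods;
-- let Y consist of these.  In a path every vertex but the last is followed by a neighbour, so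
-- at most h + 1 vertices of Y lie in X without any of their low-degree neighbours.  On the other
-- hand a uniformly random X isolates each vertex of Y independently and with probability
-- bounded below, so having only h + 1 of them isolated is exponentially unlikely.

-- Why one threshold does not suffice: at a single threshold t, Markov's inequality only gives h at
-- most D n / t. This is of the same order as the number n / ((4 D + 2) t) of separated vertices
-- that can be guaranteed. The argument needs h smaller than that number by a factor 2 K, where K =
-- 2 ^ (2 D + 2) - 1. The contributions 2 ^ i h summed over all scales stay below 2 Σ deg, so among
-- boundedly many scales one of them gains any prescribed constant factor. Why 2 K: each separated
-- vertex multiplies the count of sets by K / (K + 1), at most 2 ^ (- 1 / K), while each high-degree
-- vertex may cost a factor 2. With 2 K h at most the number of separated vertices, half of the
-- saving survives. Estimates with fractional exponents are stated in integer powers: M ^ e * 2 ^ n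
-- ≤ 2 ^ e * 2 ^ (e * n) stands for M ≤ 2 · 2 ^ ((1 - 1 / e) n), and the final constant is 1 / e.

private variable
  k m n : ℕ
  A : Set

^-distribʳ-* : ∀ a b c → (a * b) ^ c ≡ a ^ c * b ^ c
^-distribʳ-* a b zero    = refl
^-distribʳ-* a b (suc c) = trans (cong (a * b *_) (^-distribʳ-* a b c)) (e a b (a ^ c) (b ^ c))
  where
  e : ∀ a b x y → a * b * (x * y) ≡ a * x * (b * y)
  e = solve-∀

^-swap : ∀ a b c → (a ^ b) ^ c ≡ (a ^ c) ^ b
^-swap a b c = trans (^-*-assoc a b c) (trans (cong (a ^_) (*-comm b c)) (sym (^-*-assoc a c b)))

length-allFin : ∀ n → length (allFin n) ≡ n
length-allFin n = Listₚ.length-tabulate {n = n} λ i → i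


-- The order of the reals

0<½* : ∀ {ε} → 0ℚ ℚ.< ε → 0ℚ ℚ.< ½ ℚ.* ε
0<½* {ε} 0<ε = ℚₚ.positive⁻¹ (½ ℚ.* ε) {{ℚₚ.pos*pos⇒pos ½ ε {{ℚ.positive 0<ε}}}}

-- Sums of the same weights in another order agree term by term but carry different Cauchy proofs,
-- so they are compared through their sequences and not by `_≡_`.
≤ᴿ-pointwise : ∀ {x y} → (∀ n → seq x n ≡ seq y n) → x ≤ᴿ y
≤ᴿ-pointwise {x} {y} h ε 0<ε = 0 , λ n _ → begin
  seq x n        ≡⟨ h n ⟩
  seq y n        ≡⟨ ℚₚ.+-identityʳ (seq y n) ⟨
  seq y n ℚ.+ 0ℚ   ≤⟨ ℚₚ.+-monoʳ-≤ (seq y n) (ℚₚ.<⇒≤ 0<ε) ⟩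
  seq y n ℚ.+ ε    ∎
  where open ℚₚ.≤-Reasoning

≤ᴿ-refl : ∀ {x} → x ≤ᴿ x
≤ᴿ-refl {x} = ≤ᴿ-pointwise {x} {x} λ _ → refl

≤ᴿ-trans : ∀ {x y z} → x ≤ᴿ y → y ≤ᴿ z → x ≤ᴿ z
≤ᴿ-trans {x} {y} {z} h k ε 0<ε with h (½ ℚ.* ε) (0<½* 0<ε) | k (½ ℚ.* ε) (0<½* 0<ε)
... | M , p | N , q = M + N , λ n ≤n → begin
  seq x n                      ≤⟨ p n (m+n≤o⇒m≤o M ≤n) ⟩
  seq y n ℚ.+ ½ ℚ.* ε              ≤⟨ ℚₚ.+-monoˡ-≤ (½ ℚ.* ε) (q n (m+n≤o⇒n≤o M ≤n)) ⟩
  seq z n ℚ.+ ½ ℚ.* ε ℚ.+ ½ ℚ.* ε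
    ≡⟨ solve 2 (λ a e → a :+ con ½ :* e :+ con ½ :* e := a :+ e) refl (seq z n) ε ⟩
  seq z n ℚ.+ ε                  ∎
  where
  open ℚₚ.≤-Reasoning
  open +-*-Solver

+ᴿ-monoʳ-≤ : ∀ c {x y} → x ≤ᴿ y → (c +ᴿ x) ≤ᴿ (c +ᴿ y)
+ᴿ-monoʳ-≤ c {x} {y} h ε 0<ε with h ε 0<ε
... | N , p = N , λ n ≤n → begin
  seq c n ℚ.+ seq x n        ≤⟨ ℚₚ.+-monoʳ-≤ (seq c n) (p n ≤n) ⟩
  seq c n ℚ.+ (seq y n ℚ.+ ε)  ≡⟨ ℚₚ.+-assoc (seq c n) (seq y n) ε ⟨
  seq c n ℚ.+ seq y n ℚ.+ ε    ∎
  where open ℚₚ.≤-Reasoning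

∣p-q∣≤δ⇒p≤q+δ : ∀ p q {δ} → ℚ.∣ p ℚ.- q ∣ ℚ.≤ δ → p ℚ.≤ q ℚ.+ δ
∣p-q∣≤δ⇒p≤q+δ p q {δ} h = begin
  p                ≡⟨ solve 2 (λ p q → p := q :+ (p :- q)) refl p q ⟩
  q ℚ.+ (p ℚ.- q)      ≤⟨ ℚₚ.+-monoʳ-≤ q (p≤∣p∣ (p ℚ.- q)) ⟩
  q ℚ.+ ℚ.∣ p ℚ.- q ∣    ≤⟨ ℚₚ.+-monoʳ-≤ q h ⟩
  q ℚ.+ δ            ∎
  where
  open ℚₚ.≤-Reasoning
  open +-*-Solver
  p≤∣p∣ : ∀ p → p ℚ.≤ ℚ.∣ p ∣
  p≤∣p∣ p with ℚₚ.≤-total 0ℚ p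
  ... | inj₁ 0≤p = ℚₚ.≤-reflexive (sym (ℚₚ.0≤p⇒∣p∣≡p 0≤p))
  ... | inj₂ p≤0 = ℚₚ.≤-trans p≤0 (ℚₚ.0≤∣p∣ p)

-- Both terms are eventually within δ of their N-th value, so comparing the N-th values
-- settles one of the two inequalities.
≰ᴿ⇒≥ᴿ : ∀ {x y} → ¬ (x ≤ᴿ y) → y ≤ᴿ x
≰ᴿ⇒≥ᴿ {x} {y} x≰y ε 0<ε
  with cauchy x (½ ℚ.* (½ ℚ.* ε)) (0<½* (0<½* 0<ε)) | cauchy y (½ ℚ.* (½ ℚ.* ε)) (0<½* (0<½* 0<ε))
... | M , p | M′ , q with seq y (M + M′) ℚ.≤? seq x (M + M′) ℚ.+ ½ ℚ.* ε
...   | yes y≤x = M + M′ , λ n ≤n → begin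
  seq y n
    ≤⟨ ∣p-q∣≤δ⇒p≤q+δ (seq y n) (seq y N) (q n N (m+n≤o⇒n≤o M ≤n) (m≤n+m M′ M)) ⟩
  seq y N ℚ.+ δ                             ≤⟨ ℚₚ.+-monoˡ-≤ δ y≤x ⟩
  seq x N ℚ.+ ½ ℚ.* ε ℚ.+ δ                     ≤⟨ ℚₚ.+-monoˡ-≤ δ (ℚₚ.+-monoˡ-≤ (½ ℚ.* ε)
           (∣p-q∣≤δ⇒p≤q+δ (seq x N) (seq x n) (p N n (m≤m+n M M′) (m+n≤o⇒m≤o M ≤n)))) ⟩
  seq x n ℚ.+ δ ℚ.+ ½ ℚ.* ε ℚ.+ δ
    ≡⟨ solve 2 (λ a e → a :+ con ½ :* (con ½ :* e) :+ con ½ :* e :+ con ½ :* (con ½ :* e) := a :+ e)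
         refl (seq x n) ε ⟩
  seq x n ℚ.+ ε                             ∎
  where
  open ℚₚ.≤-Reasoning
  open +-*-Solver
  N = M + M′
  δ = ½ ℚ.* (½ ℚ.* ε)
...   | no  y≰x = contradiction
  (λ η 0<η → M + M′ , λ n ≤n → begin
    seq x n
      ≤⟨ ∣p-q∣≤δ⇒p≤q+δ (seq x n) (seq x N) (p n N (m+n≤o⇒m≤o M ≤n) (m≤m+n M M′)) ⟩
    seq x N ℚ.+ δ
      ≡⟨ solve 2 (λ a e → a :+ con ½ :* (con ½ :* e) := a :+ con ½ :* e :- con ½ :* (con ½ :* e))
           refl (seq x N) ε ⟩
    seq x N ℚ.+ ½ ℚ.* ε ℚ.- δ     ≤⟨ ℚₚ.+-monoˡ-≤ (ℚ.- δ) (ℚₚ.<⇒≤ (ℚₚ.≰⇒> y≰x)) ⟩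
    seq y N ℚ.- δ
      ≤⟨ ℚₚ.+-monoˡ-≤ (ℚ.- δ)
           (∣p-q∣≤δ⇒p≤q+δ (seq y N) (seq y n) (q N n (m≤n+m M′ M) (m+n≤o⇒n≤o M ≤n))) ⟩
    seq y n ℚ.+ δ ℚ.- δ         ≡⟨ solve 2 (λ a d → a :+ d :- d := a :+ con 0ℚ) refl (seq y n) δ ⟩
    seq y n ℚ.+ 0ℚ            ≤⟨ ℚₚ.+-monoʳ-≤ (seq y n) (ℚₚ.<⇒≤ 0<η) ⟩
    seq y n ℚ.+ η             ∎)
  x≰y
  where
  open ℚₚ.≤-Reasoning
  open +-*-Solver
  N = M + M′
  δ = ½ ℚ.* (½ ℚ.* ε)

-- Sets of vertices with few isolated vertices

ind : Bool → ℕ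
ind b = if b then 1 else 0

-- Splitting on the first bit matches the branching of a trie, which later turns this sum into a
-- bound on the number of stored states.
sumV : (Vec Bool n → ℕ) → ℕ
sumV {zero}  f = f []
sumV {suc n} f = sumV (λ X → f (false ∷ X)) + sumV (λ X → f (true ∷ X))

sumV-mono : {f g : Vec Bool n → ℕ} → (∀ X → f X ≤ g X) → sumV f ≤ sumV g
sumV-mono {zero}  h = h []
sumV-mono {suc n} h = +-mono-≤ (sumV-mono λ X → h (false ∷ X)) (sumV-mono λ X → h (true ∷ X))

sumV-cong : {f g : Vec Bool n → ℕ} → (∀ X → f X ≡ g X) → sumV f ≡ sumV g
sumV-cong {zero}  h = h []
sumV-cong {suc n} h = cong₂ _+_ (sumV-cong λ X → h (false ∷ X)) (sumV-cong λ X → h (true ∷ X))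

sumV-+ : (f g : Vec Bool n → ℕ) → sumV (λ X → f X + g X) ≡ sumV f + sumV g
sumV-+ {zero}  f g = refl
sumV-+ {suc n} f g = trans (cong₂ _+_ (sumV-+ (λ X → f (false ∷ X)) λ X → g (false ∷ X))
               (sumV-+ (λ X → f (true ∷ X)) λ X → g (true ∷ X)))
  (eq (sumV λ X → f (false ∷ X)) (sumV λ X → g (false ∷ X))
      (sumV λ X → f (true ∷ X)) (sumV λ X → g (true ∷ X)))
  where
  eq : ∀ a b c d → a + b + (c + d) ≡ a + c + (b + d)
  eq = solve-∀

sumV-* : ∀ c (f : Vec Bool n → ℕ) → sumV (λ X → c * f X) ≡ c * sumV f
sumV-* {zero}  c f = refl
sumV-* {suc n} c f = trans (cong₂ _+_ (sumV-* c λ X → f (false ∷ X)) (sumV-* c λ X → f (true ∷ X)))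
  (sym (*-distribˡ-+ c (sumV λ X → f (false ∷ X)) (sumV λ X → f (true ∷ X))))

sumV-1 : ∀ n → sumV {n} (λ _ → 1) ≡ 2 ^ n
sumV-1 zero    = refl
sumV-1 (suc n) = cong₂ _+_ (sumV-1 n) (trans (sumV-1 n) (sym (+-identityʳ _)))

-- Overwriting one coordinate is 2 to 1 onto its image, so each term of `sumV h` occurs at most
-- twice.
sumV-update : ∀ (h : Vec Bool n → ℕ) u b → sumV (λ X → h (X [ u ]≔ b)) ≤ 2 * sumV h
sumV-update h zero false = begin
  S₀ + S₀            ≤⟨ m≤m+n (S₀ + S₀) (2 * S₁) ⟩
  S₀ + S₀ + 2 * S₁    ≡⟨ eq S₀ S₁ ⟩
  2 * (S₀ + S₁)      ∎
  where
  open ≤-Reasoning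
  S₀ = sumV λ X → h (false ∷ X)
  S₁ = sumV λ X → h (true ∷ X)
  eq : ∀ a b → a + a + 2 * b ≡ 2 * (a + b)
  eq = solve-∀
sumV-update h zero true = begin
  S₁ + S₁            ≤⟨ m≤m+n (S₁ + S₁) (2 * S₀) ⟩
  S₁ + S₁ + 2 * S₀    ≡⟨ eq S₀ S₁ ⟩
  2 * (S₀ + S₁)      ∎
  where
  open ≤-Reasoning
  S₀ = sumV λ X → h (false ∷ X)
  S₁ = sumV λ X → h (true ∷ X)
  eq : ∀ a b → b + b + 2 * a ≡ 2 * (a + b)
  eq = solve-∀
sumV-update h (suc u) b = ≤-trans
  (+-mono-≤ (sumV-update (λ X → h (false ∷ X)) u b) (sumV-update (λ X → h (true ∷ X)) u b))
  (≤-reflexive (sym (*-distribˡ-+ 2 (sumV λ X → h (false ∷ X)) (sumV λ X → h (true ∷ X)))))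

clear : List (Fin n) → Vec Bool n → Vec Bool n
clear []       X = X
clear (u ∷ us) X = clear us X [ u ]≔ false

isolate : Fin n → List (Fin n) → Vec Bool n → Vec Bool n
isolate y us X = clear us X [ y ]≔ true

sumV-clear : ∀ (h : Vec Bool n → ℕ) us → sumV (h ∘ clear us) ≤ 2 ^ length us * sumV h
sumV-clear h []       = ≤-reflexive (sym (+-identityʳ _))
sumV-clear h (u ∷ us) = begin
  sumV (λ X → h (clear us X [ u ]≔ false))        ≤⟨ sumV-clear (λ X → h (X [ u ]≔ false)) us ⟩
  2 ^ length us * sumV (λ X → h (X [ u ]≔ false))
    ≤⟨ *-monoʳ-≤ (2 ^ length us) (sumV-update h u false) ⟩
  2 ^ length us * (2 * sumV h)                    ≡⟨ eq (2 ^ length us) (sumV h) ⟩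
  2 * 2 ^ length us * sumV h                      ∎
  where
  open ≤-Reasoning
  eq : ∀ a b → a * (2 * b) ≡ 2 * a * b
  eq = solve-∀

sumV-isolate : ∀ (h : Vec Bool n → ℕ) y us →
  sumV (h ∘ isolate y us) ≤ 2 ^ suc (length us) * sumV h
sumV-isolate h y us = begin
  sumV (λ X → h (clear us X [ y ]≔ true))        ≤⟨ sumV-clear (λ X → h (X [ y ]≔ true)) us ⟩
  2 ^ length us * sumV (λ X → h (X [ y ]≔ true))
    ≤⟨ *-monoʳ-≤ (2 ^ length us) (sumV-update h y true) ⟩
  2 ^ length us * (2 * sumV h)                   ≡⟨ eq (2 ^ length us) (sumV h) ⟩
  2 * 2 ^ length us * sumV h                     ∎
  where
  open ≤-Reasoning
  eq : ∀ a b → a * (2 * b) ≡ 2 * a * b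
  eq = solve-∀

lookup-clear-∉ : ∀ us {u : Fin n} X → u ∉ us → lookup (clear us X) u ≡ lookup X u
lookup-clear-∉ []       X u∉ = refl
lookup-clear-∉ (v ∷ us) X u∉ = trans
  (Vecₚ.lookup∘update′ (u∉ ∘ here) (clear us X) false)
  (lookup-clear-∉ us X (u∉ ∘ there))

lookup-clear-∈ : ∀ us {u : Fin n} X → u ∈ us → lookup (clear us X) u ≡ false
lookup-clear-∈ (v ∷ us) {u} X u∈ with u Finₚ.≟ v
... | yes refl = Vecₚ.lookup∘update u (clear us X) false
... | no  u≢v  with u∈
...   | here u≡v  = contradiction u≡v u≢v
...   | there u∈′ = trans (Vecₚ.lookup∘update′ u≢v (clear us X) false) (lookup-clear-∈ us X u∈′)

lookup-isolate-∉ : ∀ y us {u : Fin n} X → u ∉ y ∷ us → lookup (isolate y us X) u ≡ lookup X u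
lookup-isolate-∉ y us X u∉ =
  trans (Vecₚ.lookup∘update′ (u∉ ∘ here) (clear us X) true) (lookup-clear-∉ us X (u∉ ∘ there))

avoids : List (Fin n) → Vec Bool n → Bool
avoids []       X = true
avoids (u ∷ us) X = not (lookup X u) ∧ avoids us X

isolated : Fin n → List (Fin n) → Vec Bool n → Bool
isolated y us X = lookup X y ∧ avoids us X

avoids-cong : ∀ us {X Y : Vec Bool n} → (∀ {u} → u ∈ us → lookup X u ≡ lookup Y u) →
              avoids us X ≡ avoids us Y
avoids-cong []       h = refl
avoids-cong (u ∷ us) h = cong₂ (λ a b → not a ∧ b) (h (here refl)) (avoids-cong us (h ∘ there))

isolated-cong : ∀ y us {X Y : Vec Bool n} → (∀ {u} → u ∈ y ∷ us → lookup X u ≡ lookup Y u) →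
                isolated y us X ≡ isolated y us Y
isolated-cong y us h = cong₂ _∧_ (h (here refl)) (avoids-cong us (h ∘ there))

avoids-clear : ∀ us {X : Vec Bool n} → (∀ {u} → u ∈ us → lookup X u ≡ false) → avoids us X ≡ true
avoids-clear []       h = refl
avoids-clear (u ∷ us) h rewrite h (here refl) = avoids-clear us (h ∘ there)

isolated-isolate : ∀ y us (X : Vec Bool n) → y ∉ us → isolated y us (isolate y us X) ≡ true
isolated-isolate y us X y∉ = cong₂ _∧_ (Vecₚ.lookup∘update y (clear us X) true)
  (avoids-clear us λ {u} u∈ → trans
    (Vecₚ.lookup∘update′ (λ { refl → y∉ u∈ }) (clear us X) true)
    (lookup-clear-∈ us X u∈))

avoids-lookup : ∀ us {X : Vec Bool n} {u} → avoids us X ≡ true → u ∈ us → lookup X u ≡ false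
avoids-lookup (u ∷ us) {X} eq (here refl) with lookup X u
... | false = refl
avoids-lookup (v ∷ us) {X} eq (there u∈) with lookup X v
... | false = avoids-lookup us eq u∈

-- Markov's inequality for the score below bounds the number of sets with few isolated
-- vertices.
factor : Bool → ℕ
factor b = if b then 1 else 2

module _ {n} (N : Fin n → List (Fin n)) where

  block : Fin n → List (Fin n)
  block y = y ∷ N y

  Disjoint : Fin n → Fin n → Set
  Disjoint y z = ∀ {u} → u ∈ block y → u ∉ block z

  score : List (Fin n) → Vec Bool n → ℕ
  score []      X = 1
  score (y ∷ Y) X = factor (isolated y (N y) X) * score Y X

  #isolated : List (Fin n) → Vec Bool n → ℕ
  #isolated Y X = sum (map (λ y → ind (isolated y (N y) X)) Y)

  -- This is the independence of the events: isolating `y` rewrites only its own block, which no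
  -- other block meets.
  score-isolate : ∀ y Y X → All (Disjoint y) Y → score Y (isolate y (N y) X) ≡ score Y X
  score-isolate y []      X []       = refl
  score-isolate y (z ∷ Y) X (d ∷ ds) = cong₂ (λ b → factor b *_)
    (isolated-cong z (N z) {isolate y (N y) X} {X} λ u∈ →
      lookup-isolate-∉ y (N y) X λ u∈′ → d u∈′ u∈)
    (score-isolate y Y X ds)

  -- Thus the score is 2 to the number of vertices of `Y` that are not isolated, and sets with few
  -- isolated vertices have a large score. Its sum is the exponential moment for Markov's
  -- inequality.
  score-2^ : ∀ Y X → 2 ^ length Y ≡ 2 ^ #isolated Y X * score Y X
  score-2^ []      X = refl
  score-2^ (y ∷ Y) X with isolated y (N y) X
  ... | true  = trans (cong (2 *_) (score-2^ Y X)) (eq (2 ^ #isolated Y X) (score Y X))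
    where
    eq : ∀ a b → 2 * (a * b) ≡ 2 * a * (1 * b)
    eq = solve-∀
  ... | false = trans (cong (2 *_) (score-2^ Y X)) (eq (2 ^ #isolated Y X) (score Y X))
    where
    eq : ∀ a b → 2 * (a * b) ≡ a * (2 * b)
    eq = solve-∀

  few-isolated : List (Fin n) → ℕ → Vec Bool n → ℕ
  few-isolated Y m X = ind (#isolated Y X ≤ᵇ m)

  few-isolated-≤ : ∀ Y m → 2 ^ length Y * sumV (few-isolated Y m) ≤ 2 ^ m * sumV (score Y)
  few-isolated-≤ Y m = begin
    2 ^ length Y * sumV (few-isolated Y m)       ≡⟨ sumV-* (2 ^ length Y) (few-isolated Y m) ⟨
    sumV (λ X → 2 ^ length Y * few-isolated Y m X) ≤⟨ sumV-mono pointwise ⟩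
    sumV (λ X → 2 ^ m * score Y X)               ≡⟨ sumV-* (2 ^ m) (score Y) ⟩
    2 ^ m * sumV (score Y)                       ∎
    where
    open ≤-Reasoning
    pointwise : ∀ X → 2 ^ length Y * few-isolated Y m X ≤ 2 ^ m * score Y X
    pointwise X with #isolated Y X ≤ᵇ m in eq
    ... | false = ≤-trans (≤-reflexive (*-zeroʳ (2 ^ length Y))) z≤n
    ... | true  = begin
      2 ^ length Y * 1              ≡⟨ *-identityʳ (2 ^ length Y) ⟩
      2 ^ length Y                  ≡⟨ score-2^ Y X ⟩
      2 ^ #isolated Y X * score Y X
        ≤⟨ *-monoˡ-≤ (score Y X) (^-monoʳ-≤ 2 (≤ᵇ⇒≤ (#isolated Y X) m (subst T (sym eq) _))) ⟩
      2 ^ m * score Y X             ∎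

  -- The quotient K / 2 ^ k = 2 - 2 ^ - k bounds the average of one factor, which is 1 with
  -- probability at least 2 ^ - k and 2 otherwise. Naming `K` avoids subtraction.
  module _ (k K : ℕ) (K≡ : suc K ≡ 2 * 2 ^ k) where

    -- Isolating y is at most 2 ^ k to 1 and preserves the other factors, so the sets in
    -- which y is isolated carry a fraction 2 ^ - k of the total score.
    score-step : ∀ y Y → y ∉ N y → suc (length (N y)) ≤ k → All (Disjoint y) Y →
      2 ^ k * sumV (score (y ∷ Y)) ≤ K * sumV (score Y)
    score-step y Y y∉ len ds = +-cancelʳ-≤ S _ _ (begin
      2 ^ k * F + S           ≤⟨ +-monoʳ-≤ (2 ^ k * F) S≤ ⟩
      2 ^ k * F + 2 ^ k * V   ≡⟨ *-distribˡ-+ (2 ^ k) F V ⟨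
      2 ^ k * (F + V)         ≡⟨ cong (2 ^ k *_) F+V ⟩
      2 ^ k * (2 * S)         ≡⟨ eq (2 ^ k) S ⟩
      2 * 2 ^ k * S           ≡⟨ cong (_* S) K≡ ⟨
      suc K * S               ≡⟨ +-comm S (K * S) ⟩
      K * S + S               ∎)
      where
      open ≤-Reasoning
      eq : ∀ a b → a * (2 * b) ≡ 2 * a * b
      eq = solve-∀
      v : Vec Bool n → ℕ
      v X = ind (isolated y (N y) X)
      S = sumV (score Y)
      F = sumV (score (y ∷ Y))
      V = sumV λ X → v X * score Y X
      factor+ind : ∀ b s → factor b * s + ind b * s ≡ 2 * s
      factor+ind true  = solve-∀
      factor+ind false = solve-∀
      F+V : F + V ≡ 2 * S
      F+V = trans (sym (sumV-+ (score (y ∷ Y)) λ X → v X * score Y X))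
        (trans (sumV-cong λ X → factor+ind (isolated y (N y) X) (score Y X)) (sumV-* 2 (score Y)))
      S≤ : S ≤ 2 ^ k * V
      S≤ = begin
        S ≡⟨ sumV-cong (λ X → trans (sym (*-identityˡ (score Y X)))
               (cong₂ (λ b s → ind b * s)
                 (sym (isolated-isolate y (N y) X y∉)) (sym (score-isolate y Y X ds)))) ⟩
        sumV ((λ X → v X * score Y X) ∘ isolate y (N y))
          ≤⟨ sumV-isolate (λ X → v X * score Y X) y (N y) ⟩
        2 ^ suc (length (N y)) * V ≤⟨ *-monoˡ-≤ V (^-monoʳ-≤ 2 len) ⟩
        2 ^ k * V ∎

    score-total : ∀ Y → All (λ y → y ∉ N y × suc (length (N y)) ≤ k) Y → AllPairs Disjoint Y →
      (2 ^ k) ^ length Y * sumV (score Y) ≤ K ^ length Y * 2 ^ n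
    score-total []      _ _ = +-mono-≤ (≤-reflexive (sumV-1 n)) z≤n
    score-total (y ∷ Y) ((y∉ , len) ∷ as) (d ∷ ds) = begin
      2 ^ k * (2 ^ k) ^ length Y * sumV (score (y ∷ Y))
        ≡⟨ eq (2 ^ k) ((2 ^ k) ^ length Y) (sumV (score (y ∷ Y))) ⟩
      (2 ^ k) ^ length Y * (2 ^ k * sumV (score (y ∷ Y)))
        ≤⟨ *-monoʳ-≤ ((2 ^ k) ^ length Y) (score-step y Y y∉ len d) ⟩
      (2 ^ k) ^ length Y * (K * sumV (score Y))
        ≡⟨ eq′ ((2 ^ k) ^ length Y) K (sumV (score Y)) ⟩
      K * ((2 ^ k) ^ length Y * sumV (score Y))
        ≤⟨ *-monoʳ-≤ K (score-total Y as ds) ⟩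
      K * (K ^ length Y * 2 ^ n) ≡⟨ *-assoc K (K ^ length Y) (2 ^ n) ⟨
      K * K ^ length Y * 2 ^ n ∎
      where
      open ≤-Reasoning
      eq : ∀ a b c → a * b * c ≡ b * (a * c)
      eq = solve-∀
      eq′ : ∀ a b c → a * (b * c) ≡ b * (a * c)
      eq′ = solve-∀

    -- Markov's inequality divides the total score by 2 ^ (length Y - m). The division by 2 ^ length
    -- Y turns each average K / 2 ^ k into K / (2 · 2 ^ k) = K / (K + 1).
    count-few-isolated : ∀ Y m → All (λ y → y ∉ N y × suc (length (N y)) ≤ k) Y →
      AllPairs Disjoint Y →
      suc K ^ length Y * sumV (few-isolated Y m) ≤ 2 ^ (m + n) * K ^ length Y
    count-few-isolated Y m as ds = begin
      suc K ^ l * M                        ≡⟨ cong (λ z → z ^ l * M) K≡ ⟩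
      (2 * 2 ^ k) ^ l * M                  ≡⟨ cong (_* M) (^-distribʳ-* 2 (2 ^ k) l) ⟩
      2 ^ l * (2 ^ k) ^ l * M              ≡⟨ eq (2 ^ l) ((2 ^ k) ^ l) M ⟩
      (2 ^ k) ^ l * (2 ^ l * M)            ≤⟨ *-monoʳ-≤ ((2 ^ k) ^ l) (few-isolated-≤ Y m) ⟩
      (2 ^ k) ^ l * (2 ^ m * sumV (score Y)) ≡⟨ eq′ ((2 ^ k) ^ l) (2 ^ m) (sumV (score Y)) ⟩
      2 ^ m * ((2 ^ k) ^ l * sumV (score Y)) ≤⟨ *-monoʳ-≤ (2 ^ m) (score-total Y as ds) ⟩
      2 ^ m * (K ^ l * 2 ^ n)              ≡⟨ eq″ (2 ^ m) (K ^ l) (2 ^ n) ⟩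
      2 ^ m * 2 ^ n * K ^ l                ≡⟨ cong (_* K ^ l) (^-distribˡ-+-* 2 m n) ⟨
      2 ^ (m + n) * K ^ l                  ∎
      where
      open ≤-Reasoning
      l = length Y
      M = sumV (few-isolated Y m)
      eq : ∀ a b c → a * b * c ≡ b * (a * c)
      eq = solve-∀
      eq′ : ∀ a b c → a * (b * c) ≡ b * (a * c)
      eq′ = solve-∀
      eq″ : ∀ a b c → a * (b * c) ≡ a * c * b
      eq″ = solve-∀

-- Degrees and separated vertices

length-sum : (xs : List A) → length xs ≡ sum (map (λ _ → 1) xs)
length-sum []       = refl
length-sum (x ∷ xs) = cong suc (length-sum xs)

sum-map-mono : ∀ {f g : A → ℕ} xs → (∀ {x} → x ∈ xs → f x ≤ g x) → sum (map f xs) ≤ sum (map g xs)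
sum-map-mono []       h = z≤n
sum-map-mono (x ∷ xs) h = +-mono-≤ (h (here refl)) (sum-map-mono xs (h ∘ there))

sum-map-+ : ∀ (f g : A → ℕ) xs → sum (map (λ x → f x + g x) xs) ≡ sum (map f xs) + sum (map g xs)
sum-map-+ f g []       = refl
sum-map-+ f g (x ∷ xs) = trans (cong (λ z → f x + g x + z) (sum-map-+ f g xs))
  (eq (f x) (g x) (sum (map f xs)) (sum (map g xs)))
  where
  eq : ∀ a b c d → a + b + (c + d) ≡ a + c + (b + d)
  eq = solve-∀

sum-map-* : ∀ c (f : A → ℕ) xs → sum (map (λ x → c * f x) xs) ≡ c * sum (map f xs)
sum-map-* c f []       = sym (*-zeroʳ c)
sum-map-* c f (x ∷ xs) = trans (cong (λ z → c * f x + z) (sum-map-* c f xs))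
  (sym (*-distribˡ-+ c (f x) (sum (map f xs))))

-- Each positive term is matched with an occurrence in `ys`, which is then removed; uniqueness of
-- `xs` keeps the later matches available. Only positive terms must occur in `ys`, because of `Y`
-- only the isolated vertices are known to lie on the path.
sum-⊆ : ∀ (f : A → ℕ) {xs ys} → Unique xs → (∀ {x} → x ∈ xs → 0 < f x → x ∈ ys) →
        sum (map f xs) ≤ sum (map f ys)
sum-⊆ f {[]}     {ys} []       h = z≤n
sum-⊆ f {x ∷ xs} {ys} (x∉ ∷ u) h with f x in fx
... | zero  = sum-⊆ f u (h ∘ there)
... | suc m with as , bs , refl ← ∈-∃++ (h (here refl) (subst (0 <_) (sym fx) z<s)) = begin
  suc m + sum (map f xs)         ≤⟨ +-monoʳ-≤ (suc m) (sum-⊆ f u inside) ⟩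
  suc m + sum (map f (as ++ bs)) ≡⟨ cong (_+ sum (map f (as ++ bs))) fx ⟨
  sum (map f (x ∷ as ++ bs))     ≡⟨ sum-↭ (Perm.map⁺ f (Perm.shift x as bs)) ⟨
  sum (map f (as ++ x ∷ bs))     ∎
  where
  open ≤-Reasoning
  inside : ∀ {y} → y ∈ xs → 0 < f y → y ∈ as ++ bs
  inside y∈ 0<fy with ∈-++⁻ as (h (there y∈) 0<fy)
  ... | inj₁ y∈as         = ∈-++⁺ˡ y∈as
  ... | inj₂ (here refl)  = contradiction refl (All.lookup x∉ y∈)
  ... | inj₂ (there y∈bs) = ∈-++⁺ʳ as y∈bs

length-⊆ : ∀ {xs ys : List A} → Unique xs → (∀ {x} → x ∈ xs → x ∈ ys) → length xs ≤ length ys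
length-⊆ {xs = xs} {ys} u h = subst₂ _≤_ (sym (length-sum xs)) (sym (length-sum ys))
  (sum-⊆ (λ _ → 1) u λ x∈ _ → h x∈)

length-filterᵇ : ∀ (p : A → Bool) xs → length (filterᵇ p xs) ≡ sum (map (ind ∘ p) xs)
length-filterᵇ p []       = refl
length-filterᵇ p (x ∷ xs) with p x
... | true  = cong suc (length-filterᵇ p xs)
... | false = length-filterᵇ p xs

length-filter-¬ : ∀ {P : A → Set} (P? : ∀ x → Dec (P x)) xs →
  length xs ≡ length (filter P? xs) + length (filter (¬? ∘ P?) xs)
length-filter-¬ P? []       = refl
length-filter-¬ P? (x ∷ xs) with P? x
... | yes _ = cong suc (length-filter-¬ P? xs)
... | no  _ = trans (cong suc (length-filter-¬ P? xs)) (sym (+-suc _ _))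

length-concatMap : ∀ {B : Set} (f : A → List B) {b} xs → (∀ {x} → x ∈ xs → length (f x) ≤ b) →
  length (concatMap f xs) ≤ length xs * b
length-concatMap f []       h = z≤n
length-concatMap f (x ∷ xs) h = ≤-trans (≤-reflexive (Listₚ.length-++ (f x)))
  (+-mono-≤ (h (here refl)) (length-concatMap f xs (h ∘ there)))

_∈?_ : (z : Fin n) (zs : List (Fin n)) → Dec (z ∈ zs)
_∈?_ = DecMembership._∈?_ Finₚ._≟_

outside? : (zs : List (Fin n)) → ∀ z → Dec (z ∉ zs)
outside? zs z = ¬? (z ∈? zs)

-- Choosing `y` discards all of `C y` from the rest of the list, so each choice uses up at most `q`
-- entries. Separation is obtained only from earlier to later choices. The fuel makes the recursion
-- on the filtered list structural.
greedy : ∀ (C : Fin n → List (Fin n)) q fuel L → length L ≤ fuel → Unique L →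
  (∀ y → y ∈ C y) → (∀ {y} → y ∈ L → length (C y) ≤ q) →
  ∃[ Y ] ((∀ {y} → y ∈ Y → y ∈ L) × AllPairs (λ y z → z ∉ C y) Y × length L ≤ q * length Y)
greedy C q fuel       []      _ _ _ _ = [] , (λ ()) , [] , z≤n
greedy C q (suc fuel) (y ∷ L) (s≤s len) (y∉ ∷ u) y∈C small
  with Y , Y⊆ , sep , L≤ ← greedy C q fuel (filter (outside? (C y)) L)
                             (≤-trans (Listₚ.length-filter (outside? (C y)) L) len)
                             (Uniqueₚ.filter⁺ (outside? (C y)) u) y∈C
                             (λ z∈ → small (there (proj₁ (∈-filter⁻ (outside? (C y)) {xs = L} z∈))))
  = y ∷ Y
  , (λ { (here refl) → here refl
       ; (there z∈) → there (proj₁ (∈-filter⁻ (outside? (C y)) {xs = L} (Y⊆ z∈))) })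
  , All.tabulate (λ z∈ → proj₂ (∈-filter⁻ (outside? (C y)) {xs = L} (Y⊆ z∈))) ∷ sep
  , bound
  where
  rest  = filter (outside? (C y)) L
  hit = filter (_∈? C y) L
  -- As `y` lies in `C y` itself, `q` pays for `y` together with the discarded entries.
  hit≤ : suc (length hit) ≤ length (C y)
  hit≤ = length-⊆ {xs = y ∷ hit}
    (All.tabulate (λ z∈ → All.lookup y∉ (proj₁ (∈-filter⁻ (_∈? C y) {xs = L} z∈)))
      ∷ Uniqueₚ.filter⁺ (_∈? C y) u)
    λ { (here refl) → y∈C y ; (there z∈) → proj₂ (∈-filter⁻ (_∈? C y) {xs = L} z∈) }
  bound : suc (length L) ≤ q * suc (length Y)
  bound = begin
    suc (length L)                 ≡⟨ cong suc (length-filter-¬ (_∈? C y) L) ⟩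
    suc (length hit) + length rest ≤⟨ +-mono-≤ (≤-trans hit≤ (small (here refl))) L≤ ⟩
    q + q * length Y               ≡⟨ *-suc q (length Y) ⟨
    q * suc (length Y)             ∎
    where open ≤-Reasoning

-- Dyadic degree thresholds

powersBelow : ℕ → ℕ → ℕ
powersBelow zero    d = 0
powersBelow (suc I) d = powersBelow I d + 2 ^ I * (if d <ᵇ 2 ^ I then 0 else 1)

powersBelow<2^ : ∀ I d → suc (powersBelow I d) ≤ 2 ^ I
powersBelow<2^ zero    d = ≤-refl
powersBelow<2^ (suc I) d = begin
  suc (powersBelow I d) + 2 ^ I * (if d <ᵇ 2 ^ I then 0 else 1)
    ≤⟨ +-mono-≤ (powersBelow<2^ I d) (*-monoʳ-≤ (2 ^ I) (≤1 (d <ᵇ 2 ^ I))) ⟩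
  2 ^ I + 2 ^ I * 1 ≡⟨ cong (λ z → 2 ^ I + z) (*-comm (2 ^ I) 1) ⟩
  2 * 2 ^ I ∎
  where
  open ≤-Reasoning
  ≤1 : ∀ b → (if b then 0 else 1) ≤ 1
  ≤1 true  = z≤n
  ≤1 false = ≤-refl

-- The largest power counted is at most `d`, and all smaller powers together stay below it.
powersBelow≤ : ∀ I d → powersBelow I d ≤ 2 * d
powersBelow≤ zero    d = z≤n
powersBelow≤ (suc I) d with d <ᵇ 2 ^ I in eq
... | true  = ≤-trans
  (≤-reflexive (trans (cong (λ z → powersBelow I d + z) (*-zeroʳ (2 ^ I))) (+-identityʳ _)))
  (powersBelow≤ I d)
... | false = begin
  powersBelow I d + 2 ^ I * 1 ≤⟨ +-mono-≤ (≤-trans (n≤1+n _) (powersBelow<2^ I d)) ≤-refl ⟩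
  2 ^ I + 2 ^ I * 1           ≡⟨ cong (λ z → 2 ^ I + z) (*-comm (2 ^ I) 1) ⟩
  2 * 2 ^ I                   ≤⟨ *-monoʳ-≤ 2 (≮⇒≥ {d} {2 ^ I} λ d< → subst T eq (<⇒<ᵇ d<)) ⟩
  2 * d                       ∎
  where open ≤-Reasoning

module _ (deg : A → ℕ) (vs : List A) where

  #high : ℕ → ℕ
  #high τ = sum (map (λ v → if deg v <ᵇ τ then 0 else 1) vs)

  -- Every scale that fails adds at least m + 1 to a double sum over scales and vertices; exchanging
  -- the order of summation collects the scales of one vertex into `powersBelow`.
  scale-or-sum : ∀ R m I → (∃[ i ] (i ≤ I × R * #high (2 ^ i) * 2 ^ i ≤ m)) ⊎
    I * suc m ≤ R * sum (map (powersBelow I ∘ deg) vs)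
  scale-or-sum R m zero    = inj₂ z≤n
  scale-or-sum R m (suc I) with scale-or-sum R m I | R * #high (2 ^ I) * 2 ^ I ≤? m
  ... | inj₁ (i , i≤I , h) | _     = inj₁ (i , m≤n⇒m≤1+n i≤I , h)
  ... | inj₂ _             | yes h = inj₁ (I , n≤1+n I , h)
  ... | inj₂ s             | no h  = inj₂ (begin
    suc m + I * suc m ≤⟨ +-mono-≤ (≰⇒> h) s ⟩
    R * H * 2 ^ I + R * S ≡⟨ eq R H (2 ^ I) S ⟩
    R * (S + 2 ^ I * H)   ≡⟨ cong (λ z → R * (S + z)) (sum-map-* (2 ^ I) _ vs) ⟨
    R * (S + sum (map (λ v → 2 ^ I * (if deg v <ᵇ 2 ^ I then 0 else 1)) vs))
      ≡⟨ cong (R *_) (sum-map-+ (powersBelow I ∘ deg) _ vs) ⟨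
    R * sum (map (powersBelow (suc I) ∘ deg) vs) ∎)
    where
    open ≤-Reasoning
    H = #high (2 ^ I)
    S = sum (map (powersBelow I ∘ deg) vs)
    eq : ∀ a b c d → a * b * c + a * d ≡ a * (d + c * b)
    eq = solve-∀

  -- Each of the scales i contributes Σ_v [ 2 ^ i ≤ deg v ] · 2 ^ i, and together they
  -- contribute at most 2 Σ deg; so some scale contributes little.
  good-scale : ∀ D R → sum (map deg vs) ≤ D * length vs →
    ∃[ i ] (i ≤ suc (R * (2 * D)) × R * #high (2 ^ i) * 2 ^ i ≤ length vs)
  good-scale D R Σ≤ with scale-or-sum R (length vs) (suc (R * (2 * D)))
  ... | inj₁ s = s
  ... | inj₂ h = contradiction h (<⇒≱ (begin-strict
    R * sum (map (powersBelow I ∘ deg) vs)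
      ≤⟨ *-monoʳ-≤ R (sum-map-mono vs λ {v} _ → powersBelow≤ I (deg v)) ⟩
    R * sum (map (λ v → 2 * deg v) vs) ≡⟨ cong (R *_) (sum-map-* 2 deg vs) ⟩
    R * (2 * sum (map deg vs))         ≤⟨ *-monoʳ-≤ R (*-monoʳ-≤ 2 Σ≤) ⟩
    R * (2 * (D * length vs))          ≡⟨ eq R D (length vs) ⟩
    R * (2 * D) * length vs
      <⟨ s≤s (≤-trans (*-monoʳ-≤ (R * (2 * D)) (n≤1+n (length vs))) (m≤n+m _ (length vs))) ⟩
    I * suc (length vs)                ∎))
    where
    open ≤-Reasoning
    I = suc (R * (2 * D))
    eq : ∀ a b c → a * (2 * (b * c)) ≡ a * (2 * b) * c
    eq = solve-∀

  -- Markov's inequality: a vertex outside the list has degree at least 2 D + 1, more than twice the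
  -- average. The term 2 D ℓ is added on both sides to avoid subtraction.
  low-majority : ∀ D → sum (map deg vs) ≤ D * length vs →
    length vs ≤ 2 * length (filterᵇ (λ v → deg v ≤ᵇ 2 * D) vs)
  low-majority D Σ≤ = *-cancelʳ-≤ ℓ (2 * L) (suc (2 * D)) (+-cancelʳ-≤ (2 * (D * ℓ)) _ _ (begin
    ℓ * suc (2 * D) + 2 * (D * ℓ)                     ≤⟨ m≤m+n _ ℓ ⟩
    ℓ * suc (2 * D) + 2 * (D * ℓ) + ℓ                 ≡⟨ eq ℓ D ⟩
    2 * (suc (2 * D) * ℓ)
      ≡⟨ cong (λ z → 2 * (suc (2 * D) * z)) (length-sum vs) ⟩
    2 * (suc (2 * D) * sum (map (λ _ → 1) vs))
      ≡⟨ cong (2 *_) (sum-map-* (suc (2 * D)) (λ _ → 1) vs) ⟨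
    2 * sum (map (λ _ → suc (2 * D) * 1) vs)
      ≤⟨ *-monoʳ-≤ 2 (sum-map-mono vs λ {v} _ → pointwise v) ⟩
    2 * sum (map (λ v → deg v + suc (2 * D) * ind (low v)) vs)
      ≡⟨ cong (2 *_) (sum-map-+ deg _ vs) ⟩
    2 * (sum (map deg vs) + sum (map (λ v → suc (2 * D) * ind (low v)) vs))
      ≡⟨ cong (λ z → 2 * (sum (map deg vs) + z)) (sum-map-* (suc (2 * D)) (ind ∘ low) vs) ⟩
    2 * (sum (map deg vs) + suc (2 * D) * sum (map (ind ∘ low) vs))
      ≡⟨ cong (λ z → 2 * (sum (map deg vs) + suc (2 * D) * z)) (length-filterᵇ low vs) ⟨
    2 * (sum (map deg vs) + suc (2 * D) * L)
      ≤⟨ *-monoʳ-≤ 2 (+-monoˡ-≤ (suc (2 * D) * L) Σ≤) ⟩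
    2 * (D * ℓ + suc (2 * D) * L)                     ≡⟨ eq′ (D * ℓ) (suc (2 * D)) L ⟩
    2 * L * suc (2 * D) + 2 * (D * ℓ)                 ∎))
    where
    open ≤-Reasoning
    low : A → Bool
    low v = deg v ≤ᵇ 2 * D
    ℓ = length vs
    L = length (filterᵇ low vs)
    eq : ∀ l d → l * suc (2 * d) + 2 * (d * l) + l ≡ 2 * (suc (2 * d) * l)
    eq = solve-∀
    eq′ : ∀ a b c → 2 * (a + b * c) ≡ 2 * c * b + 2 * a
    eq′ = solve-∀
    pointwise : ∀ v → suc (2 * D) * 1 ≤ deg v + suc (2 * D) * ind (low v)
    pointwise v with low v in eq
    ... | true  = m≤n+m _ (deg v)
    ... | false = ≤-trans (≤-reflexive (*-identityʳ (suc (2 * D))))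
      (≤-trans (≰⇒> λ h → subst T eq (≤⇒≤ᵇ h)) (m≤m+n (deg v) _))

-- Bernoulli's inequality 1 + j / K ≤ (1 + 1 / K) ^ j with denominators cleared.
bernoulli : ∀ K j → K ^ j * (K + j) ≤ suc K ^ j * K
bernoulli K zero    = ≤-reflexive (cong (1 *_) (+-identityʳ K))
bernoulli K (suc j) = begin
  K * K ^ j * (K + suc j)       ≤⟨ m≤m+n _ (K ^ j * j) ⟩
  K * K ^ j * (K + suc j) + K ^ j * j ≡⟨ eq K (K ^ j) j ⟩
  suc K * (K ^ j * (K + j))     ≤⟨ *-monoʳ-≤ (suc K) (bernoulli K j) ⟩
  suc K * (suc K ^ j * K)       ≡⟨ *-assoc (suc K) (suc K ^ j) K ⟨
  suc K * suc K ^ j * K         ∎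
  where
  open ≤-Reasoning
  eq : ∀ k p j → k * p * (k + suc j) + p * j ≡ suc k * (p * (k + j))
  eq = solve-∀

[1+1/K]^K≥2 : ∀ K .{{_ : NonZero K}} → K ^ K * 2 ≤ suc K ^ K
[1+1/K]^K≥2 K = *-cancelʳ-≤ _ _ K (≤-trans (≤-reflexive (eq (K ^ K) K)) (bernoulli K K))
  where
  eq : ∀ p k → p * 2 * k ≡ p * (k + k)
  eq = solve-∀

-- Raising the hypothesis to the power 2 K turns (1 + 1 / K) ^ ℓ into at least 2 ^ (2 ℓ),
-- half of which pays for 2 ^ (2 K h).
bound-arithmetic : ∀ K .{{_ : NonZero K}} n h ℓ q Q M →
  suc K ^ ℓ * M ≤ 2 ^ (suc h + n) * K ^ ℓ →
  2 * K * h ≤ ℓ → n ≤ q * ℓ → q ≤ Q →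
  M ^ (2 * K * Q) * 2 ^ n ≤ 2 ^ (2 * K * Q) * 2 ^ (2 * K * Q * n)
bound-arithmetic K n h ℓ q Q M hM h≤ n≤ q≤ = begin
  M ^ (2 * K * Q) * 2 ^ n
    ≤⟨ *-monoʳ-≤ (M ^ (2 * K * Q)) (^-monoʳ-≤ 2
         (≤-trans n≤ (≤-trans (*-monoˡ-≤ ℓ q≤) (≤-reflexive (*-comm Q ℓ))))) ⟩
  M ^ (2 * K * Q) * 2 ^ (ℓ * Q)
    ≡⟨ cong₂ _*_ (^-*-assoc M (2 * K) Q) (^-*-assoc 2 ℓ Q) ⟨
  (M ^ (2 * K)) ^ Q * (2 ^ ℓ) ^ Q
    ≡⟨ ^-distribʳ-* (M ^ (2 * K)) (2 ^ ℓ) Q ⟨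
  (M ^ (2 * K) * 2 ^ ℓ) ^ Q
    ≤⟨ ^-monoˡ-≤ Q step₂ ⟩
  (2 ^ (2 * K + 2 * K * n)) ^ Q
    ≡⟨ ^-*-assoc 2 (2 * K + 2 * K * n) Q ⟩
  2 ^ ((2 * K + 2 * K * n) * Q)
    ≡⟨ cong (2 ^_) (eq₁ K n Q) ⟩
  2 ^ (2 * K * Q + 2 * K * Q * n)
    ≡⟨ ^-distribˡ-+-* 2 (2 * K * Q) (2 * K * Q * n) ⟩
  2 ^ (2 * K * Q) * 2 ^ (2 * K * Q * n) ∎
  where
  open ≤-Reasoning
  eq₁ : ∀ k n q → (2 * k + 2 * k * n) * q ≡ 2 * k * q + 2 * k * q * n
  eq₁ = solve-∀
  eq₂ : ∀ k h n → (suc h + n) * k * 2 ≡ 2 * k + 2 * k * n + 2 * k * h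
  eq₂ = solve-∀
  instance
    K^≢0 : NonZero ((K ^ K) ^ ℓ)
    K^≢0 = m^n≢0 (K ^ K) ℓ {{m^n≢0 K K}}
    2^≢0 : NonZero (2 ^ ℓ)
    2^≢0 = m^n≢0 2 ℓ
  step₁ : M ^ K * 2 ^ ℓ ≤ 2 ^ ((suc h + n) * K)
  step₁ = *-cancelʳ-≤ _ _ ((K ^ K) ^ ℓ) (begin
    M ^ K * 2 ^ ℓ * (K ^ K) ^ ℓ     ≡⟨ eq (M ^ K) (2 ^ ℓ) ((K ^ K) ^ ℓ) ⟩
    (K ^ K) ^ ℓ * 2 ^ ℓ * M ^ K     ≡⟨ cong (_* M ^ K) (^-distribʳ-* (K ^ K) 2 ℓ) ⟨
    (K ^ K * 2) ^ ℓ * M ^ K         ≤⟨ *-monoˡ-≤ (M ^ K) (^-monoˡ-≤ ℓ ([1+1/K]^K≥2 K)) ⟩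
    (suc K ^ K) ^ ℓ * M ^ K         ≡⟨ cong (_* M ^ K) (^-swap (suc K) K ℓ) ⟩
    (suc K ^ ℓ) ^ K * M ^ K         ≡⟨ ^-distribʳ-* (suc K ^ ℓ) M K ⟨
    (suc K ^ ℓ * M) ^ K             ≤⟨ ^-monoˡ-≤ K hM ⟩
    (2 ^ (suc h + n) * K ^ ℓ) ^ K   ≡⟨ ^-distribʳ-* (2 ^ (suc h + n)) (K ^ ℓ) K ⟩
    (2 ^ (suc h + n)) ^ K * (K ^ ℓ) ^ K ≡⟨ cong₂ _*_ (^-*-assoc 2 (suc h + n) K) (^-swap K ℓ K) ⟩
    2 ^ ((suc h + n) * K) * (K ^ K) ^ ℓ ∎)
    where
    eq : ∀ a b c → a * b * c ≡ c * b * a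
    eq = solve-∀
  step₂ : M ^ (2 * K) * 2 ^ ℓ ≤ 2 ^ (2 * K + 2 * K * n)
  step₂ = *-cancelʳ-≤ _ _ (2 ^ ℓ) (begin
    M ^ (2 * K) * 2 ^ ℓ * 2 ^ ℓ
      ≡⟨ cong (λ z → M ^ z * 2 ^ ℓ * 2 ^ ℓ) (*-comm 2 K) ⟩
    M ^ (K * 2) * 2 ^ ℓ * 2 ^ ℓ
      ≡⟨ cong (λ z → z * 2 ^ ℓ * 2 ^ ℓ) (^-*-assoc M K 2) ⟨
    (M ^ K) ^ 2 * 2 ^ ℓ * 2 ^ ℓ
      ≡⟨ eq (M ^ K) (2 ^ ℓ) ⟩
    (M ^ K * 2 ^ ℓ) ^ 2 ≤⟨ ^-monoˡ-≤ 2 step₁ ⟩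
    (2 ^ ((suc h + n) * K)) ^ 2 ≡⟨ ^-*-assoc 2 ((suc h + n) * K) 2 ⟩
    2 ^ ((suc h + n) * K * 2) ≡⟨ cong (2 ^_) (eq₂ K h n) ⟩
    2 ^ (2 * K + 2 * K * n + 2 * K * h) ≤⟨ ^-monoʳ-≤ 2 (+-monoʳ-≤ (2 * K + 2 * K * n) h≤) ⟩
    2 ^ (2 * K + 2 * K * n + ℓ) ≡⟨ ^-distribˡ-+-* 2 (2 * K + 2 * K * n) ℓ ⟩
    2 ^ (2 * K + 2 * K * n) * 2 ^ ℓ ∎)
    where
    eq : ∀ a b → a * (a * 1) * b * b ≡ (a * b) * ((a * b) * 1)
    eq = solve-∀

-- Vertex sets of paths

infix 4 _∋≡_

_∋≡_ : Vec Bool n → List (Fin n) → Set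
X ∋≡ vs = ∀ u → (lookup X u ≡ true → u ∈ vs) × (u ∈ vs → lookup X u ≡ true)

module _ {n} (G : Graph n) where

  nbrs : Fin n → List (Fin n)
  nbrs v = filterᵇ (adj G v) (allFin n)

  ∈-nbrs⁻ : ∀ {u v} → u ∈ nbrs v → Adj G v u
  ∈-nbrs⁻ {v = v} u∈ = proj₂ (∈-filter⁻ (T? ∘ adj G v) {xs = allFin n} u∈)

  ∈-nbrs⁺ : ∀ {u v} → Adj G v u → u ∈ nbrs v
  ∈-nbrs⁺ {u} {v} a = ∈-filter⁺ (T? ∘ adj G v) (∈-allFin u) a

  Adj-sym : ∀ {u v} → Adj G u v → Adj G v u
  Adj-sym {u} {v} = subst T (adj-sym G u v)

  module _ (τ : ℕ) where

    lowNbrs : Fin n → List (Fin n)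
    lowNbrs v = filterᵇ (λ u → deg G u <ᵇ τ) (nbrs v)

    ∈-lowNbrs⁻ : ∀ {u v} → u ∈ lowNbrs v → u ∈ nbrs v × T (deg G u <ᵇ τ)
    ∈-lowNbrs⁻ {v = v} u∈ = ∈-filter⁻ (λ u → T? (deg G u <ᵇ τ)) {xs = nbrs v} u∈

    ∉-lowNbrs : ∀ v → v ∉ lowNbrs v
    ∉-lowNbrs v v∈ = subst T (adj-irrefl G v) (∈-nbrs⁻ (proj₁ (∈-lowNbrs⁻ v∈)))

    length-lowNbrs : ∀ v → length (lowNbrs v) ≤ deg G v
    length-lowNbrs v = Listₚ.length-filter (λ u → T? (deg G u <ᵇ τ)) (nbrs v)

    high : Fin n → ℕ
    high v = if deg G v <ᵇ τ then 0 else 1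

    -- These are the vertices `z` whose block contains `u`: either z = u, or `u` is a low-degree
    -- neighbour of `z`. A high-degree `u` lies in no block but its own, and this keeps the list
    -- within τ entries.
    reach : Fin n → List (Fin n)
    reach u = u ∷ (if deg G u <ᵇ τ then nbrs u else [])

    conflicts : Fin n → List (Fin n)
    conflicts y = concatMap reach (block lowNbrs y)

    length-reach : 1 ≤ τ → ∀ u → length (reach u) ≤ τ
    length-reach 1≤τ u with deg G u <ᵇ τ in eq
    ... | true  = <ᵇ⇒< (deg G u) τ (subst T (sym eq) _)
    ... | false = 1≤τ

    length-conflicts : 1 ≤ τ → ∀ D {y} → deg G y ≤ D → length (conflicts y) ≤ suc D * τ
    length-conflicts 1≤τ D {y} h = ≤-trans
      (length-concatMap reach (block lowNbrs y) λ {u} _ → length-reach 1≤τ u)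
      (*-monoˡ-≤ τ (s≤s (≤-trans (length-lowNbrs y) h)))

    reach⊆conflicts : ∀ {y u z} → u ∈ block lowNbrs y → z ∈ reach u → z ∈ conflicts y
    reach⊆conflicts {y} u∈ z∈ =
      ∈-concatMap⁺ reach {xs = block lowNbrs y} (Any.map (λ { refl → z∈ }) u∈)

    self-conflict : ∀ y → y ∈ conflicts y
    self-conflict y = here refl

    non-conflict : ∀ {y z} → z ∉ conflicts y → Disjoint lowNbrs y z
    non-conflict z∉ u∈ (here refl) = z∉ (reach⊆conflicts u∈ (here refl))
    non-conflict {y} {z} z∉ {u} u∈ (there u∈z)
      with u∈nbrs , low ← ∈-lowNbrs⁻ u∈z =
        z∉ (reach⊆conflicts u∈ (there (subst (λ b → z ∈ (if b then nbrs u else []))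
          (sym (Equivalence.to T-≡ low)) (∈-nbrs⁺ (Adj-sym (∈-nbrs⁻ u∈nbrs))))))

    bad : Vec Bool n → Fin n → ℕ
    bad X y = ind (isolated y (lowNbrs y) X)

    bad≤1 : ∀ X y → bad X y ≤ 1
    bad≤1 X y with isolated y (lowNbrs y) X
    ... | true  = ≤-refl
    ... | false = z≤n

    -- An isolated `u` has no low-degree neighbour in `X`, so its neighbour `v` in `X` must have
    -- high degree.
    bad-next : ∀ X {u v} → Adj G u v → lookup X v ≡ true → bad X u ≤ high v
    bad-next X {u} {v} a v∈X with lookup X u | avoids (lowNbrs u) X in av | deg G v <ᵇ τ in low
    ... | false | _     | _     = z≤n
    ... | true  | false | _     = z≤n
    ... | true  | true  | false = ≤-refl
    ... | true  | true  | true  = contradiction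
      (trans (sym v∈X) (avoids-lookup (lowNbrs u) av
        (∈-filter⁺ (λ u → T? (deg G u <ᵇ τ)) (∈-nbrs⁺ a) (subst T (sym low) _))))
      λ ()

    -- Charge an isolated vertex of a path to its successor, which must have high degree.
    bad-path : ∀ X u vs → Linked (Adj G) (u ∷ vs) → (∀ {v} → v ∈ vs → lookup X v ≡ true) →
      sum (map (bad X) (u ∷ vs)) ≤ suc (sum (map high vs))
    bad-path X u []       _       _ = +-mono-≤ (bad≤1 X u) z≤n
    bad-path X u (v ∷ vs) (a ∷ l) h = begin
      bad X u + sum (map (bad X) (v ∷ vs))
        ≤⟨ +-mono-≤ (bad-next X a (h (here refl))) (bad-path X v vs l (h ∘ there)) ⟩
      high v + suc (sum (map high vs)) ≡⟨ +-suc (high v) _ ⟩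
      suc (high v + sum (map high vs)) ∎
      where open ≤-Reasoning

    -- An isolated vertex belongs to `X` and hence to the path, so the sum over `Y` is controlled by
    -- the sum along `vs`. The path meets every high-degree vertex at most once.
    bad-count : ∀ X vs → Unique vs → Linked (Adj G) vs → X ∋≡ vs → ∀ {Y} → Unique Y →
      #isolated lowNbrs Y X ≤ suc (#high (deg G) (allFin n) τ)
    bad-count X vs u l X∋ {Y} uY = begin
      sum (map (bad X) Y)  ≤⟨ sum-⊆ (bad X) uY (λ {y} _ → inside y) ⟩
      sum (map (bad X) vs) ≤⟨ go vs u l (λ {v} v∈ → proj₂ (X∋ v) v∈) ⟩
      suc (#high (deg G) (allFin n) τ) ∎
      where
      open ≤-Reasoning
      inside : ∀ y → 0 < bad X y → y ∈ vs
      inside y 0< with lookup X y in eq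
      ... | true = proj₁ (X∋ y) eq
      go : ∀ vs → Unique vs → Linked (Adj G) vs → (∀ {v} → v ∈ vs → lookup X v ≡ true) →
           sum (map (bad X) vs) ≤ suc (#high (deg G) (allFin n) τ)
      go []       _       _ _ = z≤n
      go (v ∷ vs) (_ ∷ u) l h = ≤-trans (bad-path X v vs l (h ∘ there))
        (s≤s (sum-⊆ high u λ {v} _ _ → ∈-allFin v))

-- Constants that depend only on the degree bound

module _ (D : ℕ) where
  private
    -- Bounds the size of a block: a vertex of degree at most 2 D together with its low-degree
    -- neighbours.
    κ : ℕ
    κ = suc (2 * D)

  blockBase : ℕ
  blockBase = pred (2 * 2 ^ κ)

  private
    K : ℕ
    K = blockBase

    K≡ : suc K ≡ 2 * 2 ^ κ
    K≡ = suc-pred (2 * 2 ^ κ) {{m^n≢0 2 (suc κ)}}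

    instance
      K≢0 : NonZero K
      K≢0 = >-nonZero (s≤s⁻¹ (subst (2 ≤_) (sym K≡) (*-monoʳ-≤ 2 (m^n>0 2 κ))))

  -- Chosen for n ≤ `separation i` · |Y|: half of the vertices have degree at most 2 D, and each
  -- greedy choice discards at most (2 D + 1) 2 ^ i of them.
  separation : ℕ → ℕ
  separation i = 2 * (suc (2 * D) * 2 ^ i)

  separation≢0 : ∀ i → NonZero (separation i)
  separation≢0 i = m*n≢0 2 (suc (2 * D) * 2 ^ i) {{_}}
    {{m*n≢0 (suc (2 * D)) (2 ^ i) {{_}} {{m^n≢0 2 i}}}}

  -- With this factor a good scale gives 2 K h ≤ |Y|, since `separation i` is 2 ^ i times
  -- `separation 0`.
  scaleFactor : ℕ
  scaleFactor = 2 * K * separation 0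

  maxScale : ℕ
  maxScale = suc (scaleFactor * (2 * D))

  -- The good scale depends on the graph, but the exponent must not; so the largest possible
  -- separation is used.
  exponent : ℕ
  exponent = 2 * K * separation maxScale

  exponent≢0 : NonZero exponent
  exponent≢0 = m*n≢0 (2 * K) (separation maxScale) {{m*n≢0 2 K}} {{separation≢0 maxScale}}

  -- The function `good` dominates the indicator of the vertex sets of paths, so `sumV good` bounds
  -- their number.
  few-path-sets : ∀ {n} (G : Graph n) → sum (map (deg G) (allFin n)) ≤ D * n →
    ∃[ good ] (∀ X vs → Unique vs → Linked (Adj G) vs → X ∋≡ vs → 1 ≤ good X) ×
      sumV good ^ exponent * 2 ^ n ≤ 2 ^ exponent * 2 ^ (exponent * n)
  few-path-sets {n} G Σ≤
    with i , i≤ , scale ← good-scale (deg G) (allFin n) D scaleFactor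
           (subst (λ z → sum (map (deg G) (allFin n)) ≤ D * z) (sym (length-allFin n)) Σ≤)
    with Y , Y⊆ , sep , L≤ ← greedy (conflicts G (2 ^ i)) (suc (2 * D) * 2 ^ i) _
           (filterᵇ (λ v → deg G v ≤ᵇ 2 * D) (allFin n)) ≤-refl
           (Uniqueₚ.filter⁺ (λ v → T? (deg G v ≤ᵇ 2 * D)) (Uniqueₚ.allFin⁺ n))
           (self-conflict G (2 ^ i))
           (λ {y} y∈ → length-conflicts G (2 ^ i) (m^n>0 2 i) (2 * D)
             (≤ᵇ⇒≤ _ _ (proj₂ (∈-filter⁻ (λ v → T? (deg G v ≤ᵇ 2 * D)) {xs = allFin n} y∈))))
    = few-isolated N Y (suc h)
    , (λ X vs u l X∋ → subst (λ b → 1 ≤ ind b) (sym (Equivalence.to T-≡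
        (≤⇒≤ᵇ (bad-count G (2 ^ i) X vs u l X∋
          (AllPairs.map (λ { z∉ refl → z∉ (self-conflict G (2 ^ i) _) }) sep))))) ≤-refl)
    , bound-arithmetic K n h (length Y) (separation i) (separation maxScale)
        (sumV (few-isolated N Y (suc h)))
        (count-few-isolated N κ K K≡ Y (suc h)
          (All.tabulate λ {y} y∈ → ∉-lowNbrs G (2 ^ i) y ,
            s≤s (≤-trans (length-lowNbrs G (2 ^ i) y) (≤ᵇ⇒≤ _ _
              (proj₂ (∈-filter⁻ (λ v → T? (deg G v ≤ᵇ 2 * D)) {xs = allFin n} (Y⊆ y∈))))))
          (AllPairs.map (non-conflict G (2 ^ i)) sep))
        few-high n≤ (*-monoʳ-≤ 2 (*-monoʳ-≤ (suc (2 * D)) (^-monoʳ-≤ 2 i≤)))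
    where
    N = lowNbrs G (2 ^ i)
    h = #high (deg G) (allFin n) (2 ^ i)
    open ≤-Reasoning
    n≤ : n ≤ separation i * length Y
    n≤ = begin
      n ≡⟨ length-allFin n ⟨
      length (allFin n)
        ≤⟨ low-majority (deg G) (allFin n) D
             (subst (λ z → sum (map (deg G) (allFin n)) ≤ D * z) (sym (length-allFin n)) Σ≤) ⟩
      2 * length (filterᵇ (λ v → deg G v ≤ᵇ 2 * D) (allFin n)) ≤⟨ *-monoʳ-≤ 2 L≤ ⟩
      2 * (suc (2 * D) * 2 ^ i * length Y) ≡⟨ *-assoc 2 (suc (2 * D) * 2 ^ i) (length Y) ⟨
      separation i * length Y ∎
    few-high : 2 * K * h ≤ length Y
    few-high = *-cancelˡ-≤ (separation i) {{separation≢0 i}} (begin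
      separation i * (2 * K * h) ≡⟨ eq K (suc (2 * D)) (2 ^ i) h ⟩
      scaleFactor * h * 2 ^ i    ≤⟨ scale ⟩
      length (allFin n)          ≡⟨ length-allFin n ⟩
      n                          ≤⟨ n≤ ⟩
      separation i * length Y    ∎)
      where
      eq : ∀ κ d p h → 2 * (d * p) * (2 * κ * h) ≡ 2 * κ * (2 * (d * 1)) * h * p
      eq = solve-∀

-- Costs of evaluation

pattern 5+ i = suc (suc (suc (suc (suc i))))

pattern v0  = var zero
pattern v1  = var (suc zero)
pattern v2  = var (suc (suc zero))
pattern v3  = var (suc (suc (suc zero)))
pattern v4  = var (suc (suc (suc (suc zero))))
pattern v5  = var (5+ zero)
pattern v6  = var (5+ (suc zero))
pattern v7  = var (5+ (suc (suc zero)))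
pattern v8  = var (5+ (suc (suc (suc zero))))
pattern v9  = var (5+ (suc (suc (suc (suc zero)))))
pattern v15 = var (5+ (5+ (5+ zero)))
pattern v16 = var (5+ (5+ (5+ (suc zero))))

record Within {m} (ρ : Vec Value m) (e : Term m) (v : Value) (b : ℕ) : Set where
  constructor within
  field
    {time} : ℕ
    deriv  : ρ ⊢ e ⇓ v [ time ]
    bound  : time ≤ b

relax : ∀ {m} {ρ : Vec Value m} {e v b b′} → b ≤ b′ → Within ρ e v b → Within ρ e v b′
relax b≤b′ (within d t≤b) = within d (≤-trans t≤b b≤b′)

value-≡ : ∀ {m} {ρ : Vec Value m} {e v v′ b} → v ≡ v′ → Within ρ e v b → Within ρ e v′ b
value-≡ refl r = r

-- A cost bound a · (p + 1) + b · q + c · r.  The coefficients are numerals, found by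
-- unification when a derivation is assembled; p + 1, q and r bound the costs of
-- the calls it makes.
cost : ℕ × ℕ × ℕ → ℕ → ℕ → ℕ → ℕ
cost (p , q , r) a b c = a * suc p + (b * q + c * r)

record Run (γ : ℕ × ℕ × ℕ) {m} (ρ : Vec Value m) (e : Term m) (v : Value) (a b c : ℕ) : Set where
  constructor run
  field
    {time} : ℕ
    deriv  : ρ ⊢ e ⇓ v [ time ]
    bound  : time ≤ cost γ a b c

unit-cost : ∀ γ → 1 ≤ cost γ 1 0 0
unit-cost γ = s≤s z≤n

-- The step taken by the rule itself is charged to one more copy of the positive number p + 1, so
-- the bound keeps its shape.
add₂ : ∀ γ {s t} a b c a′ b′ c′ → s ≤ cost γ a b c → t ≤ cost γ a′ b′ c′ →
       suc (s + t) ≤ cost γ (suc (a + a′)) (b + b′) (c + c′)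
add₂ (p , q , r) {s} {t} a b c a′ b′ c′ h k = begin
  suc (s + t)                                                    ≤⟨ s≤s (+-mono-≤ h k) ⟩
  suc (cost (p , q , r) a b c + cost (p , q , r) a′ b′ c′)        ≤⟨ s≤s (m≤n+m _ p) ⟩
  suc (p + (cost (p , q , r) a b c + cost (p , q , r) a′ b′ c′))  ≡⟨ eq p q r a b c a′ b′ c′ ⟩
  cost (p , q , r) (suc (a + a′)) (b + b′) (c + c′)               ∎
  where
  open ≤-Reasoning
  eq : ∀ p q r a b c a′ b′ c′ →
       suc (p + ((a * suc p + (b * q + c * r)) + (a′ * suc p + (b′ * q + c′ * r)))) ≡
       suc (a + a′) * suc p + ((b + b′) * q + (c + c′) * r)
  eq = solve-∀

add₀ : ∀ γ {s t} a b c a′ b′ c′ → s ≤ cost γ a b c → t ≤ cost γ a′ b′ c′ →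
       s + t ≤ cost γ (a + a′) (b + b′) (c + c′)
add₀ (p , q , r) {s} {t} a b c a′ b′ c′ h k =
  subst (s + t ≤_) (eq p q r a b c a′ b′ c′) (+-mono-≤ h k)
  where
  eq : ∀ p q r a b c a′ b′ c′ →
       (a * suc p + (b * q + c * r)) + (a′ * suc p + (b′ * q + c′ * r)) ≡
       (a + a′) * suc p + ((b + b′) * q + (c + c′) * r)
  eq = solve-∀

module _ {γ : ℕ × ℕ × ℕ} {m} {ρ : Vec Value m} where

  r-var : ∀ {i} → Run γ ρ (var i) (lookup ρ i) 1 0 0
  r-var = run ⇓var (unit-cost γ)

  r-fun : ∀ {e} → Run γ ρ (fun e) (closure ρ e) 1 0 0
  r-fun = run ⇓fun (unit-cost γ)

  r-nil : Run γ ρ nil nil 1 0 0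
  r-nil = run ⇓nil (unit-cost γ)

  r-zeroW : Run γ ρ zeroW (weight 0ᴿ) 1 0 0
  r-zeroW = run ⇓zeroW (unit-cost γ)

  module _ {a b c a′ b′ c′ : ℕ} where

    r-let : ∀ {e e′ u v} → Run γ ρ e u a b c → Run γ (u ∷ ρ) e′ v a′ b′ c′ →
            Run γ ρ (letT e e′) v (suc (a + a′)) (b + b′) (c + c′)
    r-let (run d h) (run d′ h′) = run (⇓let d d′) (add₂ γ a b c a′ b′ c′ h h′)

    r-cons : ∀ {e e′ u v} → Run γ ρ e u a b c → Run γ ρ e′ v a′ b′ c′ →
             Run γ ρ (cons e e′) (cons u v) (suc (a + a′)) (b + b′) (c + c′)
    r-cons (run d h) (run d′ h′) = run (⇓cons d d′) (add₂ γ a b c a′ b′ c′ h h′)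

    r-addW : ∀ {e e′ x y} → Run γ ρ e (weight x) a b c → Run γ ρ e′ (weight y) a′ b′ c′ →
             Run γ ρ (addW e e′) (weight (x +ᴿ y)) (suc (a + a′)) (b + b′) (c + c′)
    r-addW (run d h) (run d′ h′) = run (⇓addW d d′) (add₂ γ a b c a′ b′ c′ h h′)

    r-case-nil : ∀ {e e₁ e₂ v} → Run γ ρ e nil a b c → Run γ ρ e₁ v a′ b′ c′ →
                 Run γ ρ (case e e₁ e₂) v (suc (a + a′)) (b + b′) (c + c′)
    r-case-nil (run d h) (run d′ h′) = run (⇓case-nil d d′) (add₂ γ a b c a′ b′ c′ h h′)

    r-case-cons : ∀ {e e₁ e₂ x l v} → Run γ ρ e (cons x l) a b c →
                  Run γ (x ∷ l ∷ ρ) e₂ v a′ b′ c′ →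
                  Run γ ρ (case e e₁ e₂) v (suc (a + a′)) (b + b′) (c + c′)
    r-case-cons (run d h) (run d′ h′) = run (⇓case-cons d d′) (add₂ γ a b c a′ b′ c′ h h′)

  module _ {a b c a′ b′ c′ a″ b″ c″ : ℕ} where

    r-app : ∀ {f e k} {σ : Vec Value k} {body u v} →
            Run γ ρ f (closure σ body) a b c → Run γ ρ e u a′ b′ c′ →
            Run γ (u ∷ closure σ body ∷ σ) body v a″ b″ c″ →
            Run γ ρ (app f e) v (suc (a + a′ + a″)) (b + b′ + b″) (c + c′ + c″)
    r-app (run d h) (run d′ h′) (run d″ h″) =
      run (⇓app d d′ d″)
        (add₂ γ (a + a′) (b + b′) (c + c′) a″ b″ c″ (add₀ γ a b c a′ b′ c′ h h′) h″)

    r-ifLe-yes : ∀ {e e′ e₁ e₂ x y v} →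
                 Run γ ρ e (weight x) a b c → Run γ ρ e′ (weight y) a′ b′ c′ → x ≤ᴿ y →
                 Run γ ρ e₁ v a″ b″ c″ →
                 Run γ ρ (ifLe e e′ e₁ e₂) v (suc (a + a′ + a″)) (b + b′ + b″) (c + c′ + c″)
    r-ifLe-yes (run d h) (run d′ h′) x≤y (run d″ h″) =
      run (⇓ifLe-yes d d′ x≤y d″)
        (add₂ γ (a + a′) (b + b′) (c + c′) a″ b″ c″ (add₀ γ a b c a′ b′ c′ h h′) h″)

    r-ifLe-no : ∀ {e e′ e₁ e₂ x y v} →
                Run γ ρ e (weight x) a b c → Run γ ρ e′ (weight y) a′ b′ c′ → ¬ (x ≤ᴿ y) →
                Run γ ρ e₂ v a″ b″ c″ →
                Run γ ρ (ifLe e e′ e₁ e₂) v (suc (a + a′ + a″)) (b + b′ + b″) (c + c′ + c″)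
    r-ifLe-no (run d h) (run d′ h′) x≰y (run d″ h″) =
      run (⇓ifLe-no d d′ x≰y d″)
        (add₂ γ (a + a′) (b + b′) (c + c′) a″ b″ c″ (add₀ γ a b c a′ b′ c′ h h′) h″)

-- The inner application only builds the closure that awaits the second argument; this is the one
-- step counted by the extra 1.
r-app₂ : ∀ {γ m} {ρ : Vec Value m} {f e e′ k} {σ : Vec Value k} {body u u′ v}
           {a b c a′ b′ c′ a″ b″ c″ a‴ b‴ c‴} →
         Run γ ρ f (closure σ (fun body)) a b c →
         Run γ ρ e u a′ b′ c′ → Run γ ρ e′ u′ a″ b″ c″ →
         Run γ (u′ ∷ closure (u ∷ closure σ (fun body) ∷ σ) body ∷ u ∷ closure σ (fun body) ∷ σ)
           body v a‴ b‴ c‴ →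
         Run γ ρ (app (app f e) e′) v
           (suc (suc (a + a′ + 1) + a″ + a‴)) (b + b′ + 0 + b″ + b‴) (c + c′ + 0 + c″ + c‴)
r-app₂ f e e′ body = r-app (r-app f e r-fun) e′ body

module _ {p q r m : ℕ} {ρ : Vec Value m} {e : Term m} {v : Value} where

  unit-call : ∀ {b} → b ≤ suc p → Within ρ e v b → Run (p , q , r) ρ e v 1 0 0
  unit-call b≤p (within d h) = run d (≤-trans h (≤-trans b≤p
    (≤-reflexive (eq p q r))))
    where
    eq : ∀ p q r → suc p ≡ 1 * suc p + (0 * q + 0 * r)
    eq = solve-∀

  q-call : Within ρ e v q → Run (p , q , r) ρ e v 0 1 0
  q-call (within d h) = run d (≤-trans h (≤-reflexive (eq p q r)))
    where
    eq : ∀ p q r → q ≡ 0 * suc p + (1 * q + 0 * r)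
    eq = solve-∀

  r-call : Within ρ e v r → Run (p , q , r) ρ e v 0 0 1
  r-call (within d h) = run d (≤-trans h (≤-reflexive (eq p q r)))
    where
    eq : ∀ p q r → r ≡ 0 * suc p + (0 * q + 1 * r)
    eq = solve-∀

-- All numeral coefficients are rounded up to the same 100, a check done by evaluation in `≤unit`.
-- Opacity keeps products with `unit` from being unfolded.
opaque
  unit : ℕ
  unit = 100

  ≤unit : ∀ a {_ : T (a ≤ᵇ 100)} → a ≤ unit
  ≤unit a {a≤} = ≤ᵇ⇒≤ a 100 a≤

module _ {m : ℕ} {ρ : Vec Value m} {e : Term m} {v : Value} {a : ℕ} {a≤ : T (a ≤ᵇ 100)} where

  closeₚ : ∀ p q → Run (p , q , 0) ρ e v a 1 0 → Within ρ e v (unit * suc p + q)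
  closeₚ p q (run d h) = within d (≤-trans h (+-mono-≤ (*-monoˡ-≤ (suc p) (≤unit a {a≤}))
    (≤-reflexive (trans (+-identityʳ _) (*-identityˡ q)))))

  closeₚ₀ : ∀ p → Run (p , 0 , 0) ρ e v a 0 0 → Within ρ e v (unit * suc p)
  closeₚ₀ p (run d h) =
    within d (≤-trans h (≤-trans (≤-reflexive (+-identityʳ _)) (*-monoˡ-≤ (suc p) (≤unit a {a≤}))))

  close₂ : ∀ q r → Run (0 , q , r) ρ e v a 1 1 → Within ρ e v (unit + (q + r))
  close₂ q r (run d h) = within d (≤-trans h (+-mono-≤
    (≤-trans (≤-reflexive (*-identityʳ a)) (≤unit a {a≤}))
    (≤-reflexive (cong₂ _+_ (*-identityˡ q) (*-identityˡ r)))))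

  close₁ : ∀ q → Run (0 , q , 0) ρ e v a 1 0 → Within ρ e v (unit + q)
  close₁ q (run d h) = within d (≤-trans h (+-mono-≤
    (≤-trans (≤-reflexive (*-identityʳ a)) (≤unit a {a≤}))
    (≤-reflexive (trans (+-identityʳ _) (*-identityˡ q)))))

  close₀ : Run (0 , 0 , 0) ρ e v a 0 0 → Within ρ e v unit
  close₀ (run d h) = within d
    (≤-trans h (≤-trans (≤-reflexive (trans (+-identityʳ _) (*-identityʳ a))) (≤unit a {a≤})))

-- The program

encodeVec : ∀ {n} → Vec Value n → Value
encodeVec []       = nil
encodeVec (x ∷ xs) = cons x (encodeVec xs)


-- In the body of fun (fun body), variables 0 and 2 are the second and the first argument and
-- variable 3 is the function itself.
nthBody : Term (4 + m)
nthBody = case v0 nil (case v4 v0 (app (app v7 v1) v3))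

nthT : Term m
nthT = fun (fun nthBody)

module _ {σ : Vec Value m} where
  env₂ : Term (4 + m) → Value → Value → Vec Value (4 + m)
  env₂ body u v = v ∷ closure (u ∷ closure σ (fun body) ∷ σ) body ∷ u ∷ closure σ (fun body) ∷ σ

nth-⇓ : ∀ {σ : Vec Value m} (xs : Vec Value n) u →
        Within (env₂ {σ = σ} nthBody (encodeℕ (toℕ u)) (encodeVec xs)) nthBody
          (lookup xs u) (n * unit)
nth-⇓ (x ∷ xs) zero    =
  relax (m≤m+n unit _) (close₀ (r-case-cons r-var (r-case-nil r-var r-var)))
nth-⇓ (x ∷ xs) (suc u) = close₁ _
  (r-case-cons r-var (r-case-cons r-var (r-app₂ r-var r-var r-var (q-call (nth-⇓ xs u)))))

one : Value
one = cons nil nil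

oneT : Term m
oneT = cons nil nil

setBody : Term (4 + m)
setBody = case v0 nil (case v4 (cons oneT v1) (cons v2 (app (app v7 v1) v3)))

setT : Term m
setT = fun (fun setBody)

set-⇓ : ∀ {σ : Vec Value m} (xs : Vec Value n) u →
        Within (env₂ {σ = σ} setBody (encodeℕ (toℕ u)) (encodeVec xs)) setBody
          (encodeVec (xs Vec.[ u ]≔ one)) (n * unit)
set-⇓ (x ∷ xs) zero    = relax (m≤m+n unit _)
  (close₀ (r-case-cons r-var (r-case-nil r-var (r-cons (r-cons r-nil r-nil) r-var))))
set-⇓ (x ∷ xs) (suc u) = close₁ _
  (r-case-cons r-var (r-case-cons r-var
    (r-cons r-var (r-app₂ r-var r-var r-var (q-call (set-⇓ xs u))))))

encodeBit : Bool → Value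
encodeBit false = nil
encodeBit true  = one

encodeBits : Vec Bool n → Value
encodeBits bs = encodeVec (Vec.map encodeBit bs)

encodeFin : Fin n → Value
encodeFin v = encodeℕ (toℕ v)

-- Stands for the walk vs ∷ʳ 0, of weight cst; bits is the set of the vertices in vs.
-- Vertex 0 counts as visited only when the walk returns to it.
record State (n : ℕ) : Set where
  constructor state
  field
    cst  : ℝ
    bits : Vec Bool n
    vs   : List (Fin n)

open State public

encodeState : State n → Value
encodeState (state x bs vs) = cons (weight x) (cons (encodeBits bs) (encodeList encodeFin vs))

-- Tries indexed by vertex sets

data Trie (A : Set) : ℕ → Set where
  empty : Trie A k
  leaf  : A → Trie A 0
  node  : Trie A k → Trie A k → Trie A (suc k)

-- The head of a nonempty code is a tag, `nil` for a leaf and `one` for a node, that a single `case`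
-- can tell apart.
encodeTrie : Trie (State n) k → Value
encodeTrie empty      = nil
encodeTrie (leaf s)   = cons nil (encodeState s)
encodeTrie (node l r) = cons one (cons (encodeTrie l) (encodeTrie r))

left right : ∀ {A} → Trie A (suc k) → Trie A k
left  empty      = empty
left  (node l r) = l
right empty      = empty
right (node l r) = r

module Algorithm (_≤?ᴿ_ : Decidable _≤ᴿ_) where

  insertLeaf : State n → Trie (State n) 0 → Trie (State n) 0
  insertLeaf s empty     = leaf s
  insertLeaf s (leaf s′) with cst s ≤?ᴿ cst s′
  ... | yes _ = leaf s
  ... | no  _ = leaf s′

  insert : Vec Bool k → State n → Trie (State n) k → Trie (State n) k
  insert []           s t = insertLeaf s t
  insert (true ∷ bs)  s t = node (insert bs s (left t)) (right t)
  insert (false ∷ bs) s t = node (left t) (insert bs s (right t))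

flatten : ∀ {A} → Trie A k → List A → List A
flatten empty      acc = acc
flatten (leaf s)   acc = s ∷ acc
flatten (node l r) acc = flatten l (flatten r acc)

headT : Term m → Term m
headT e = case e nil v0

insertBody : Term (5 + m)
insertBody =
  case v2
    (case v0 (cons nil v4)
      (ifLe (headT v6) (headT v1) (cons nil v6) (cons nil v1)))
    (case (case v2 (cons nil nil) v1) nil
      (cons oneT
        (case v2
          (cons v0 (app (app v7 v3) v1))
          (cons (app (app v9 v5) v2) v3))))

-- The state to be inserted is variable 0.
insertT : Term (suc m)
insertT = fun (fun insertBody)

module _ (_≤?ᴿ_ : Decidable _≤ᴿ_) where
  open Algorithm _≤?ᴿ_

  insertLeaf-⇓ : ∀ {σ : Vec Value m} (s : State n) t →
    Within (env₂ {σ = encodeState s ∷ σ} insertBody nil (encodeTrie t)) insertBody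
      (encodeTrie (insertLeaf s t)) unit
  insertLeaf-⇓ s empty =
    close₀ (r-case-nil r-var (r-case-nil r-var (r-cons r-nil r-var)))
  insertLeaf-⇓ s (leaf s′) with cst s ≤?ᴿ cst s′
  ... | yes x≤y = close₀ (r-case-nil r-var (r-case-cons r-var
          (r-ifLe-yes (r-case-cons r-var r-var) (r-case-cons r-var r-var) x≤y
            (r-cons r-nil r-var))))
  ... | no  x≰y = close₀ (r-case-nil r-var (r-case-cons r-var
          (r-ifLe-no (r-case-cons r-var r-var) (r-case-cons r-var r-var) x≰y
            (r-cons r-nil r-var))))

  -- A present node costs less than an absent one; the bound is padded to 5 so that callers need not
  -- distinguish the two.
  branches-⇓ : ∀ {γ} {ρ : Vec Value m} {e} (t : Trie (State n) (suc k)) →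
    Run γ ρ e (encodeTrie t) 1 0 0 →
    Run γ ρ (case e (cons nil nil) v1)
      (cons (encodeTrie (left t)) (encodeTrie (right t))) 5 0 0
  branches-⇓ {γ = γ} empty    e = r-case-nil e (r-cons r-nil r-nil)
  branches-⇓ {γ = γ@(p , q , r)} {ρ = ρ} (node _ _) e
    with run d h ← r-case-cons {γ = γ} {e₁ = cons nil nil} e (r-var {i = suc zero}) =
      run d (≤-trans h (+-monoˡ-≤ 0 (*-monoˡ-≤ (suc p) {3} {5} (s≤s (s≤s (s≤s z≤n))))))

  insert-⇓ : ∀ {σ : Vec Value m} (bs : Vec Bool k) (s : State n) t →
    Within (env₂ {σ = encodeState s ∷ σ} insertBody (encodeBits bs) (encodeTrie t)) insertBody
      (encodeTrie (insert bs s t)) (suc k * unit)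
  insert-⇓ []           s t = relax (m≤m+n unit _) (insertLeaf-⇓ s t)
  insert-⇓ (true ∷ bs)  s t = close₁ _
    (r-case-cons r-var (r-case-cons (branches-⇓ t r-var)
      (r-cons (r-cons r-nil r-nil) (r-case-cons r-var
        (r-cons (r-app₂ r-var r-var r-var (q-call (insert-⇓ bs s (left t)))) r-var)))))
  insert-⇓ (false ∷ bs) s t = close₁ _
    (r-case-cons r-var (r-case-cons (branches-⇓ t r-var)
      (r-cons (r-cons r-nil r-nil) (r-case-nil r-var
        (r-cons r-var (r-app₂ r-var r-var r-var (q-call (insert-⇓ bs s (right t)))))))))

flattenBody : Term (4 + m)
flattenBody =
  case v2 v0 (case v0 (cons v1 v2) (case v3 nil (app (app v9 v0) (app (app v9 v1) v6))))

flattenT : Term m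
flattenT = fun (fun flattenBody)

flattenCost : ∀ {A} → Trie A k → ℕ
flattenCost empty      = unit
flattenCost (leaf s)   = unit
flattenCost (node l r) = unit + (flattenCost l + flattenCost r)

flatten-⇓ : ∀ {σ : Vec Value m} (t : Trie (State n) k) acc →
  Within (env₂ {σ = σ} flattenBody (encodeTrie t) (encodeList encodeState acc)) flattenBody
    (encodeList encodeState (flatten t acc)) (flattenCost t)
flatten-⇓ empty      acc = close₀ (r-case-nil r-var r-var)
flatten-⇓ (leaf s)   acc =
  close₀ (r-case-cons r-var (r-case-nil r-var (r-cons r-var r-var)))
flatten-⇓ (node l r) acc = close₂ _ _
  (r-case-cons r-var (r-case-cons r-var (r-case-cons r-var
    (r-app₂ r-var r-var
      (r-app₂ r-var r-var r-var (r-call (flatten-⇓ r acc)))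
      (q-call (flatten-⇓ l (flatten r acc)))))))

-- In the context of collectT the vertex that extends the walks is variable 4, its row
-- variable 0.  The binders introduce, in this order: a state and the remaining states; the
-- trie of the latter; the weight of the state and its other components; its bits and its
-- walk; the weight of the connecting edge; the new bits; the new state.
collectBody : Term (7 + m)
collectBody =
  case v0 nil
    (letT (app v3 v1)
      (case v1 nil
        (case v1 nil
          (case (app (app nthT (case v1 nil v0)) v9) v4
            (case (app (app nthT v15) v2)
              (letT (app (app setT v15) v2)
                (letT (cons (addW v1 v5) (cons v0 (cons v16 v4)))
                  (app (app insertT v1) v8)))
              v8)))))

collectT : Term (5 + m)
collectT = fun collectBody

encodeList-tabulate : ∀ {A : Set} (f : A → Value) (g : Fin n → A) →
  encodeList f (tabulate g) ≡ encodeVec (Vec.tabulate λ i → f (g i))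
encodeList-tabulate {n = zero}  f g = refl
encodeList-tabulate {n = suc n} f g =
  cong (cons (f (g zero))) (encodeList-tabulate f λ i → g (suc i))

-- The walks end at vertex 0, which encodes as nil.
head₀ : List (Fin (suc n)) → Fin (suc n)
head₀ []      = zero
head₀ (v ∷ _) = v

module _ {G : Graph (suc n)} (w : EdgeWeights G) where

  entry : Fin (suc n) → Fin (suc n) → Value
  entry u v = if adj G u v then cons (weight (c w u v)) nil else nil

  row : Fin (suc n) → Value
  row u = encodeList (entry u) (allFin (suc n))

  extend : Fin (suc n) → State (suc n) → State (suc n)
  extend v (state x bs us) = state (c w v (head₀ us) +ᴿ x) (bs Vec.[ v ]≔ true) (v ∷ us)

  nth-row : ∀ {σ : Vec Value m} u v →
    Within (env₂ {σ = σ} nthBody (encodeFin v) (row u)) nthBody (entry u v) (suc n * unit)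
  nth-row u v
    rewrite encodeList-tabulate {n = suc n} (entry u) (λ i → i)
    = value-≡ (Vecₚ.lookup∘tabulate (entry u) v)
        (nth-⇓ (Vec.tabulate (entry u)) v)

  nth-row-edge : ∀ {σ : Vec Value m} u v → adj G u v ≡ true →
    Within (env₂ {σ = σ} nthBody (encodeFin v) (row u)) nthBody
      (cons (weight (c w u v)) nil) (suc n * unit)
  nth-row-edge {σ = σ} u v eq with r ← nth-row {σ = σ} u v rewrite eq = r

  nth-row-nonedge : ∀ {σ : Vec Value m} u v → adj G u v ≡ false →
    Within (env₂ {σ = σ} nthBody (encodeFin v) (row u)) nthBody nil (suc n * unit)
  nth-row-nonedge {σ = σ} u v eq with r ← nth-row {σ = σ} u v rewrite eq = r

nth-bits : ∀ {σ : Vec Value m} (bs : Vec Bool n) v {b} → lookup bs v ≡ b →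
  Within (env₂ {σ = σ} nthBody (encodeFin v) (encodeBits bs)) nthBody (encodeBit b) (n * unit)
nth-bits bs v refl = value-≡ (Vecₚ.lookup-map v encodeBit bs)
  (nth-⇓ (Vec.map encodeBit bs) v)

set-bits : ∀ {σ : Vec Value m} (bs : Vec Bool n) v →
  Within (env₂ {σ = σ} setBody (encodeFin v) (encodeBits bs)) setBody
    (encodeBits (bs Vec.[ v ]≔ true)) (n * unit)
set-bits bs v = value-≡ (cong encodeVec (sym (Vecₚ.map-[]≔ encodeBit bs v)))
  (set-⇓ (Vec.map encodeBit bs) v)

r-head₀ : ∀ {γ} {ρ : Vec Value m} {e} (us : List (Fin (suc n))) →
  Run γ ρ e (encodeList encodeFin us) 1 0 0 →
  Run γ ρ (case e nil v0) (encodeFin (head₀ us)) 3 0 0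
r-head₀ []      e = r-case-nil e r-nil
r-head₀ (_ ∷ _) e = r-case-cons e r-var

module Search (_≤?ᴿ_ : Decidable _≤ᴿ_) {n} {G : Graph (suc n)} (w : EdgeWeights G) where
  open Algorithm _≤?ᴿ_

  -- There is one trie for each newly added vertex `v`, so the key has to record only the set. Walks
  -- grow at the front, hence the edge tested joins `v` to the head.
  collect : Fin (suc n) → List (State (suc n)) → Trie (State (suc n)) (suc n)
  collect v []       = empty
  collect v (s ∷ ss) with adj G v (head₀ (vs s)) | lookup (bits s) v
  ... | true  | false = insert (bits (extend w v s)) (extend w v s) (collect v ss)
  ... | true  | true  = collect v ss
  ... | false | _     = collect v ss

  -- The cost of an insertion into a trie of depth `suc n`, the dearest of the auxiliary calls.
  callCost : ℕ
  callCost = suc (suc n) * unit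

  collectCost : ℕ → ℕ
  collectCost ℓ = suc ℓ * (unit * suc callCost)

  private
    fits : suc n * unit ≤ suc callCost
    fits = ≤-trans (*-monoˡ-≤ unit (n≤1+n (suc n))) (n≤1+n callCost)

  collect-⇓ : ∀ {x₁ x₂ x₃} {σ : Vec Value m} v ss →
    let τ = row w v ∷ x₁ ∷ x₂ ∷ x₃ ∷ encodeFin v ∷ σ in
    Within (encodeList encodeState ss ∷ closure τ collectBody ∷ τ) collectBody
      (encodeTrie (collect v ss)) (collectCost (length ss))
  collect-⇓ v [] = relax (m≤m+n _ 0) (closeₚ₀ callCost (r-case-nil r-var r-nil))
  collect-⇓ v (s ∷ ss)
    with adj G v (head₀ (vs s)) in edge | lookup (bits s) v in unused
  ... | false | _     = closeₚ callCost _
    (r-case-cons r-var (r-let (r-app r-var r-var (q-call (collect-⇓ v ss)))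
      (r-case-cons r-var (r-case-cons r-var
        (r-case-nil
          (r-app₂ r-fun (r-head₀ (vs s) r-var) r-var
            (unit-call fits (nth-row-nonedge w v (head₀ (vs s)) edge)))
          r-var)))))
  ... | true  | true  = closeₚ callCost _
    (r-case-cons r-var (r-let (r-app r-var r-var (q-call (collect-⇓ v ss)))
      (r-case-cons r-var (r-case-cons r-var
        (r-case-cons
          (r-app₂ r-fun (r-head₀ (vs s) r-var) r-var
            (unit-call fits (nth-row-edge w v (head₀ (vs s)) edge)))
          (r-case-cons
            (r-app₂ r-fun r-var r-var (unit-call fits (nth-bits (bits s) v unused)))
            r-var))))))
  ... | true  | false = closeₚ callCost _
    (r-case-cons r-var (r-let (r-app r-var r-var (q-call (collect-⇓ v ss)))
      (r-case-cons r-var (r-case-cons r-var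
        (r-case-cons
          (r-app₂ r-fun (r-head₀ (vs s) r-var) r-var
            (unit-call fits (nth-row-edge w v (head₀ (vs s)) edge)))
          (r-case-nil
            (r-app₂ r-fun r-var r-var (unit-call fits (nth-bits (bits s) v unused)))
            (r-let (r-app₂ r-fun r-var r-var (unit-call fits (set-bits (bits s) v)))
              (r-let (r-cons (r-addW r-var r-var) (r-cons r-var (r-cons r-var r-var)))
                (r-app₂ r-fun r-var r-var
                  (unit-call (n≤1+n callCost)
                    (insert-⇓ _≤?ᴿ_ (bits (extend w v s)) (extend w v s) (collect v ss)))))))))))) 

advanceBody : Term (5 + m)
advanceBody =
  case v0 nil (app (app flattenT (app collectT v6)) (app (app v5 (cons nil v4)) v1))

-- The list of states is variable 0.
advanceT : Term (suc m)
advanceT = fun (fun advanceBody)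

-- The first argument is a counter in the form of a list. The `letT` moves the states to variable 0,
-- where `advanceT` expects them.
iterateBody : Term (5 + m)
iterateBody = case v2 v0 (app (app v5 v1) (letT v2 (app (app advanceT nil) v7)))

-- The adjacency matrix is variable 0.
iterateT : Term (suc m)
iterateT = fun (fun iterateBody)

zerosBody : Term (2 + m)
zerosBody = case v0 nil (cons nil (app v3 v1))

zerosT : Term m
zerosT = fun zerosBody

-- All rows but the first act as the counter, one round for each vertex other than 0. A last round
-- over the first row alone lets every walk return to vertex 0.
program : Program
program =
  case v0 nil
    (case v1 nil
      (case v1 nil
        (letT v6
          (letT (app (app iterateT v6) (cons (cons zeroW (cons (app zerosT v0) nil)) nil))
            (case (app (app advanceT nil) (cons v6 nil)) nil
              (case v0 nil (case v1 nil v1)))))))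

zerosVec : ∀ n → Vec Bool n
zerosVec n = Vec.replicate n false

start : State (suc n)
start = state 0ᴿ (zerosVec _) []

zeros-⇓ : ∀ {A : Set} (f : A → Value) {σ : Vec Value m} (g : Fin n → A) →
  Within (encodeList f (tabulate g) ∷ closure σ zerosBody ∷ σ) zerosBody
    (encodeBits (zerosVec n)) (suc n * unit)
zeros-⇓ {n = zero}  f g = relax (m≤m+n unit _) (close₀ (r-case-nil r-var r-nil))
zeros-⇓ {n = suc n} f g = close₁ _
  (r-case-cons r-var (r-cons r-nil (r-app r-var r-var (q-call (zeros-⇓ f λ i → g (suc i))))))

-- The program numbers the rows by a running counter; this condition makes the counter agree with
-- the vertices.
Consecutive : ℕ → List (Fin n) → Set
Consecutive v []       = ⊤
Consecutive v (u ∷ us) = toℕ u ≡ v × Consecutive (suc v) us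

consecutive-tabulate : ∀ v (g : Fin k → Fin n) → (∀ i → toℕ (g i) ≡ v + toℕ i) →
  Consecutive v (tabulate g)
consecutive-tabulate {k = zero}  v g h = tt
consecutive-tabulate {k = suc k} v g h = trans (h zero) (+-identityʳ v) ,
  consecutive-tabulate (suc v) (λ i → g (suc i)) λ i → trans (h (suc i)) (+-suc v (toℕ i))

consecutive-allFin : Consecutive 0 (allFin n)
consecutive-allFin = consecutive-tabulate 0 (λ i → i) λ _ → refl

firstPath : List (State n) → Value
firstPath []      = nil
firstPath (s ∷ _) = encodeList encodeFin (vs s)

-- Layers of the search and their cost

module HeldKarp (_≤?ᴿ_ : Decidable _≤ᴿ_) {n} {G : Graph (suc n)} (w : EdgeWeights G) where
  open Algorithm _≤?ᴿ_
  open Search _≤?ᴿ_ w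

  advance : List (State (suc n)) → List (Fin (suc n)) → List (State (suc n))
  advance ss []       = []
  advance ss (v ∷ us) = flatten (collect v ss) (advance ss us)

  layers : List (State (suc n)) → ℕ → List (State (suc n))
  layers ss zero    = ss
  layers ss (suc i) = layers (advance ss (allFin _)) i

  -- An insertion creates at most one branch from the root to a leaf. Each level of it adds at most
  -- a node and an empty sibling, two units.
  insert-flattenCost : ∀ {k} (bs : Vec Bool k) (s : State (suc n)) t →
    flattenCost (insert bs s t) ≤ flattenCost t + suc k * (2 * unit)
  insert-flattenCost [] s empty = m≤m+n unit _
  insert-flattenCost [] s (leaf s′) with cst s ≤?ᴿ cst s′
  ... | yes _ = m≤m+n unit _
  ... | no  _ = m≤m+n unit _
  insert-flattenCost {suc k} (true ∷ bs) s empty = begin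
    unit + (flattenCost (insert bs s empty) + unit)
      ≤⟨ +-monoʳ-≤ unit (+-monoˡ-≤ unit (insert-flattenCost bs s empty)) ⟩
    unit + (unit + suc k * (2 * unit) + unit)
      ≡⟨ eq unit (suc k * (2 * unit)) ⟩
    unit + (2 * unit + suc k * (2 * unit)) ∎
    where
    open ≤-Reasoning
    eq : ∀ a b → a + (a + b + a) ≡ a + (2 * a + b)
    eq = solve-∀
  insert-flattenCost {suc k} (true ∷ bs) s (node l r) = begin
    unit + (flattenCost (insert bs s l) + flattenCost r)
      ≤⟨ +-monoʳ-≤ unit (+-monoˡ-≤ _ (insert-flattenCost bs s l)) ⟩
    unit + (flattenCost l + suc k * (2 * unit) + flattenCost r)
      ≤⟨ m≤m+n _ (2 * unit) ⟩
    unit + (flattenCost l + suc k * (2 * unit) + flattenCost r) + 2 * unit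
      ≡⟨ eq unit (flattenCost l) (flattenCost r) (suc k * (2 * unit)) ⟩
    unit + (flattenCost l + flattenCost r) + (2 * unit + suc k * (2 * unit)) ∎
    where
    open ≤-Reasoning
    eq : ∀ a l r b → a + (l + b + r) + 2 * a ≡ a + (l + r) + (2 * a + b)
    eq = solve-∀
  insert-flattenCost {suc k} (false ∷ bs) s empty = begin
    unit + (unit + flattenCost (insert bs s empty))
      ≤⟨ +-monoʳ-≤ unit (+-monoʳ-≤ unit (insert-flattenCost bs s empty)) ⟩
    unit + (unit + (unit + suc k * (2 * unit)))
      ≡⟨ eq unit (suc k * (2 * unit)) ⟩
    unit + (2 * unit + suc k * (2 * unit)) ∎
    where
    open ≤-Reasoning
    eq : ∀ a b → a + (a + (a + b)) ≡ a + (2 * a + b)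
    eq = solve-∀
  insert-flattenCost {suc k} (false ∷ bs) s (node l r) = begin
    unit + (flattenCost l + flattenCost (insert bs s r))
      ≤⟨ +-monoʳ-≤ unit (+-monoʳ-≤ _ (insert-flattenCost bs s r)) ⟩
    unit + (flattenCost l + (flattenCost r + suc k * (2 * unit)))
      ≤⟨ m≤m+n _ (2 * unit) ⟩
    unit + (flattenCost l + (flattenCost r + suc k * (2 * unit))) + 2 * unit
      ≡⟨ eq unit (flattenCost l) (flattenCost r) (suc k * (2 * unit)) ⟩
    unit + (flattenCost l + flattenCost r) + (2 * unit + suc k * (2 * unit)) ∎
    where
    open ≤-Reasoning
    eq : ∀ a l r b → a + (l + (r + b)) + 2 * a ≡ a + (l + r) + (2 * a + b)
    eq = solve-∀

  flattenBound : ℕ → ℕ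
  flattenBound ℓ = unit + ℓ * (suc (suc n) * (2 * unit))

  collect-flattenCost : ∀ v ss → flattenCost (collect v ss) ≤ flattenBound (length ss)
  collect-flattenCost v [] = m≤m+n unit 0
  collect-flattenCost v (s ∷ ss) with adj G v (head₀ (vs s)) | lookup (bits s) v
  ... | false | _     = ≤-trans (collect-flattenCost v ss)
    (+-monoʳ-≤ unit (*-monoˡ-≤ (suc (suc n) * (2 * unit)) (n≤1+n (length ss))))
  ... | true  | true  = ≤-trans (collect-flattenCost v ss)
    (+-monoʳ-≤ unit (*-monoˡ-≤ (suc (suc n) * (2 * unit)) (n≤1+n (length ss))))
  ... | true  | false = begin
    flattenCost (insert (bits (extend w v s)) (extend w v s) (collect v ss))
      ≤⟨ insert-flattenCost (bits (extend w v s)) (extend w v s) (collect v ss) ⟩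
    flattenCost (collect v ss) + B
      ≤⟨ +-monoˡ-≤ B (collect-flattenCost v ss) ⟩
    unit + length ss * B + B
      ≡⟨ eq unit (length ss * B) B ⟩
    unit + (B + length ss * B) ∎
    where
    open ≤-Reasoning
    B = suc (suc n) * (2 * unit)
    eq : ∀ a b c → a + b + c ≡ a + (c + b)
    eq = solve-∀

  advanceCost : ℕ → ℕ → ℕ
  advanceCost ℓ j = suc j * (unit * suc (collectCost ℓ + flattenBound ℓ))

  advance-⇓ : ∀ {σ : Vec Value m} ss v us → Consecutive v us →
    Within (env₂ {σ = encodeList encodeState ss ∷ σ} advanceBody (encodeℕ v)
             (encodeList (row w) us))
      advanceBody (encodeList encodeState (advance ss us)) (advanceCost (length ss) (length us))
  advance-⇓ ss v [] _ =
    relax (m≤m+n _ 0) (closeₚ₀ (collectCost (length ss) + flattenBound (length ss))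
      (r-case-nil r-var r-nil))
  advance-⇓ ss .(toℕ u) (u ∷ us) (refl , cs) = closeₚ P _
    (r-case-cons r-var
      (r-app₂ r-fun
        (r-app r-fun r-var
          (unit-call (≤-trans (m≤m+n (collectCost ℓ) (flattenBound ℓ)) (n≤1+n P)) (collect-⇓ u ss)))
        (r-app₂ r-var (r-cons r-nil r-var) r-var (q-call (advance-⇓ ss (suc (toℕ u)) us cs)))
        (unit-call
          (≤-trans (collect-flattenCost u ss)
            (≤-trans (m≤n+m (flattenBound ℓ) (collectCost ℓ)) (n≤1+n P)))
          (flatten-⇓ (collect u ss) (advance ss us)))))
    where
    ℓ = length ss
    P = collectCost ℓ + flattenBound ℓ

  advanceCost-mono : ∀ ℓ ℓ′ j → ℓ ≤ ℓ′ → advanceCost ℓ j ≤ advanceCost ℓ′ j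
  advanceCost-mono ℓ ℓ′ j h = *-monoʳ-≤ (suc j) (*-monoʳ-≤ unit (s≤s
    (+-mono-≤ (*-monoˡ-≤ (unit * suc callCost) (s≤s h))
      (+-monoʳ-≤ unit (*-monoˡ-≤ (suc (suc n) * (2 * unit)) h)))))

  advance-all-⇓ : ∀ {σ : Vec Value m} ss {Λ} → length ss ≤ Λ →
    Within (env₂ {σ = encodeList encodeState ss ∷ σ} advanceBody nil (encodeInstance G w))
      advanceBody (encodeList encodeState (advance ss (allFin (suc n)))) (advanceCost Λ (suc n))
  advance-all-⇓ ss {Λ} h = relax
    (≤-trans (advanceCost-mono (length ss) Λ (length (allFin (suc n))) h)
      (≤-reflexive (cong (advanceCost Λ) (length-allFin (suc n)))))
    (advance-⇓ ss 0 (allFin (suc n)) consecutive-allFin)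

  module _ (Λ : ℕ) where

    iterateCost : ℕ → ℕ
    iterateCost j = suc j * (unit * suc (advanceCost Λ (suc n)))

    iterate-⇓ : ∀ {A : Set} {f : A → Value} {σ : Vec Value m} (xs : List A) ss →
      (∀ i → length (layers ss i) ≤ Λ) →
      Within (env₂ {σ = encodeInstance G w ∷ σ} iterateBody (encodeList f xs)
               (encodeList encodeState ss))
        iterateBody (encodeList encodeState (layers ss (length xs))) (iterateCost (length xs))
    iterate-⇓ [] ss h =
      relax (m≤m+n _ 0) (closeₚ₀ (advanceCost Λ (suc n)) (r-case-nil r-var r-var))
    iterate-⇓ (x ∷ xs) ss h = closeₚ (advanceCost Λ (suc n)) _
      (r-case-cons r-var
        (r-app₂ r-var r-var
          (r-let r-var (r-app₂ r-fun r-nil r-var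
            (unit-call (n≤1+n _) (advance-all-⇓ ss (h 0)))))
          (q-call (iterate-⇓ xs (advance ss (allFin (suc n))) λ i → h (suc i)))))

-- A cycle has at least three vertices, so smaller graphs are rejected at once.
program-1 : {G : Graph 1} (w : EdgeWeights G) → Within (encodeInstance G w ∷ []) program nil unit
program-1 w = close₀ (r-case-cons r-var (r-case-nil r-var r-nil))

program-2 : {G : Graph 2} (w : EdgeWeights G) → Within (encodeInstance G w ∷ []) program nil unit
program-2 w = close₀ (r-case-cons r-var (r-case-cons r-var (r-case-nil r-var r-nil)))

module _ (_≤?ᴿ_ : Decidable _≤ᴿ_) {n} {G : Graph (3 + n)} (w : EdgeWeights G) where
  open HeldKarp _≤?ᴿ_ w

  r-firstPath : ∀ {γ m} {ρ : Vec Value m} {e} (ss : List (State (3 + n))) {a b c} →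
    Run γ ρ e (encodeList encodeState ss) a b c →
    Run γ ρ (case e nil (case v0 nil (case v1 nil v1))) (firstPath ss) (6 + a) b c
  r-firstPath {γ = p , q , r} [] {a} {b} {c} e
    with run d h ← r-case-nil {γ = p , q , r} {e₂ = case v0 nil (case v1 nil v1)} e r-nil =
      run d (≤-trans h (≤-trans (+-monoˡ-≤ _ (*-monoˡ-≤ (suc p) {suc (a + 1)} {6 + a}
        (≤-trans (≤-reflexive (cong suc (+-comm a 1))) (m≤n+m (2 + a) 4))))
        (≤-reflexive (cong₂ (λ x y → (6 + a) * suc p + (x * q + y * r))
          (+-identityʳ b) (+-identityʳ c)))))
  r-firstPath {γ = p , q , r} (s ∷ _) {a} {b} {c} e
    with run d h ← r-case-cons {γ = p , q , r} {e₁ = nil} e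
           (r-case-cons {e₁ = nil} r-var (r-case-cons {e₁ = nil} r-var (r-var {i = suc zero}))) =
      run d (≤-trans h (≤-reflexive (trans
        (cong (λ z → suc z * suc p + ((b + 0) * q + (c + 0) * r)) (+-comm a 5))
        (cong₂ (λ x y → (6 + a) * suc p + (x * q + y * r)) (+-identityʳ b) (+-identityʳ c)))))

  answer : List (State (3 + n))
  answer = advance (layers (start ∷ []) (2 + n)) (zero ∷ [])

  programCost : ℕ → ℕ
  programCost Λ = unit * suc ((4 + n) * unit + iterateCost Λ (2 + n) + advanceCost Λ 1)

  program-⇓ : ∀ Λ → (∀ i → length (layers (start ∷ []) i) ≤ Λ) →
    Within (encodeInstance G w ∷ []) program (firstPath answer) (programCost Λ)
  program-⇓ Λ h = closeₚ₀ P
    (r-case-cons r-var (r-case-cons r-var (r-case-cons r-var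
      (r-let r-var
        (r-let
          (r-app₂ r-fun r-var
            (r-cons (r-cons r-zeroW (r-cons
              (r-app r-fun r-var
                (unit-call (≤-trans (m≤m+n _ _) (≤-trans (m≤m+n _ _) (n≤1+n P)))
                  (zeros-⇓ (row w) λ i → i)))
              r-nil)) r-nil)
            (unit-call
              (≤-trans (≤-reflexive (cong (iterateCost Λ) (Listₚ.length-tabulate {n = 2 + n} suc)))
                (≤-trans (m≤n+m _ ((4 + n) * unit)) (≤-trans (m≤m+n _ _) (n≤1+n P))))
              (value-≡ (cong (λ i → encodeList encodeState (layers (start ∷ []) i))
                         (Listₚ.length-tabulate {n = 2 + n} suc))
                (iterate-⇓ Λ (tabulate {n = 2 + n} suc) (start ∷ []) h))))
          (r-firstPath answer
            (r-app₂ r-fun r-nil (r-cons r-var r-nil)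
              (unit-call
                (≤-trans (advanceCost-mono _ Λ 1 (h (2 + n)))
                  (≤-trans (m≤n+m _ ((4 + n) * unit + iterateCost Λ (2 + n))) (n≤1+n P)))
                (advance-⇓ (layers (start ∷ []) (2 + n)) 0 (zero ∷ []) (refl , tt))))))))))
    where
    P = (4 + n) * unit + iterateCost Λ (2 + n) + advanceCost Λ 1

-- Correctness of the search

find : Vec Bool k → Trie A k → Maybe A
find []           empty    = nothing
find []           (leaf x) = just x
find (true ∷ bs)  t        = find bs (left t)
find (false ∷ bs) t        = find bs (right t)

find-empty : ∀ (bs : Vec Bool k) → find {A = A} bs empty ≡ nothing
find-empty []           = refl
find-empty (true ∷ bs)  = find-empty bs
find-empty (false ∷ bs) = find-empty bs

∈-flatten⁻ : ∀ {s} (t : Trie A k) acc → s ∈ flatten t acc →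
             (∃[ bs ] find bs t ≡ just s) ⊎ s ∈ acc
∈-flatten⁻ empty      acc s∈         = inj₂ s∈
∈-flatten⁻ (leaf s)   acc (here refl) = inj₁ ([] , refl)
∈-flatten⁻ (leaf s)   acc (there s∈)  = inj₂ s∈
∈-flatten⁻ (node l r) acc s∈ with ∈-flatten⁻ l (flatten r acc) s∈
... | inj₁ (bs , eq) = inj₁ (true ∷ bs , eq)
... | inj₂ s∈′ with ∈-flatten⁻ r acc s∈′
...   | inj₁ (bs , eq) = inj₁ (false ∷ bs , eq)
...   | inj₂ s∈acc     = inj₂ s∈acc

∈-flatten⁺ʳ : ∀ {s} (t : Trie A k) {acc} → s ∈ acc → s ∈ flatten t acc
∈-flatten⁺ʳ empty      s∈ = s∈
∈-flatten⁺ʳ (leaf _)   s∈ = there s∈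
∈-flatten⁺ʳ (node l r) s∈ = ∈-flatten⁺ʳ l (∈-flatten⁺ʳ r s∈)

∈-flatten⁺ˡ : ∀ {s} (bs : Vec Bool k) (t : Trie A k) {acc} → find bs t ≡ just s →
              s ∈ flatten t acc
∈-flatten⁺ˡ bs           empty      eq   with () ← trans (sym eq) (find-empty bs)
∈-flatten⁺ˡ []           (leaf _)   refl = here refl
∈-flatten⁺ˡ (true ∷ bs)  (node l r) eq   = ∈-flatten⁺ˡ bs l eq
∈-flatten⁺ˡ (false ∷ bs) (node l r) eq   = ∈-flatten⁺ʳ l (∈-flatten⁺ˡ bs r eq)

-- A trie holds at most one entry per key, so any `g` that is positive on the occupied keys counts
-- them.
length-flatten : ∀ (t : Trie A k) acc g → (∀ bs {s} → find bs t ≡ just s → 1 ≤ g bs) →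
  length (flatten t acc) ≤ sumV g + length acc
length-flatten empty      acc g h = m≤n+m _ _
length-flatten (leaf s)   acc g h = +-monoˡ-≤ (length acc) (h [] refl)
length-flatten (node l r) acc g h = begin
  length (flatten l (flatten r acc))
    ≤⟨ length-flatten l (flatten r acc) gˡ (h ∘ (true ∷_)) ⟩
  sumV gˡ + length (flatten r acc)
    ≤⟨ +-monoʳ-≤ (sumV gˡ) (length-flatten r acc gʳ (h ∘ (false ∷_))) ⟩
  sumV gˡ + (sumV gʳ + length acc)  ≡⟨ +-assoc (sumV gˡ) (sumV gʳ) (length acc) ⟨
  -- `flatten` lists the branch of `true` first, while `sumV` starts with `false`.
  sumV gˡ + sumV gʳ + length acc    ≡⟨ cong (_+ length acc) (+-comm (sumV gˡ) (sumV gʳ)) ⟩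
  sumV gʳ + sumV gˡ + length acc    ∎
  where
  open ≤-Reasoning
  gˡ = g ∘ (true ∷_)
  gʳ = g ∘ (false ∷_)

module _ (_≤?ᴿ_ : Decidable _≤ᴿ_) where
  open Algorithm _≤?ᴿ_

  insert-same : ∀ (bs : Vec Bool k) (s : State n) t → ∃[ s′ ]
    (find bs (insert bs s t) ≡ just s′ × (s′ ≡ s ⊎ find bs t ≡ just s′) ×
     cst s′ ≤ᴿ cst s × (∀ {o} → find bs t ≡ just o → cst s′ ≤ᴿ cst o))
  insert-same [] s empty = s , refl , inj₁ refl , ≤ᴿ-refl {cst s} , λ ()
  insert-same [] s (leaf s′) with cst s ≤?ᴿ cst s′
  ... | yes h = s , refl , inj₁ refl , ≤ᴿ-refl {cst s} , λ { refl → h }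
  ... | no  h = s′ , refl , inj₂ refl , ≰ᴿ⇒≥ᴿ {cst s} {cst s′} h , λ { refl → ≤ᴿ-refl {cst s′} }
  insert-same (true ∷ bs)  s t = insert-same bs s (left t)
  insert-same (false ∷ bs) s t = insert-same bs s (right t)

  insert-other : ∀ (bs bs′ : Vec Bool k) (s : State n) t → bs′ ≢ bs →
    find bs′ (insert bs s t) ≡ find bs′ t
  insert-other []           []            s t neq = contradiction refl neq
  insert-other (true ∷ bs)  (true ∷ bs′)  s t neq =
    insert-other bs bs′ s (left t) (neq ∘ cong (true ∷_))
  insert-other (true ∷ bs)  (false ∷ bs′) s t neq = refl
  insert-other (false ∷ bs) (true ∷ bs′)  s t neq = refl
  insert-other (false ∷ bs) (false ∷ bs′) s t neq =
    insert-other bs bs′ s (right t) (neq ∘ cong (false ∷_))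

  insert-⁻ : ∀ (bs bs′ : Vec Bool k) (s : State n) t {s′} →
    find bs′ (insert bs s t) ≡ just s′ → (bs′ ≡ bs × s′ ≡ s) ⊎ find bs′ t ≡ just s′
  insert-⁻ bs bs′ s t eq with Vecₚ.≡-dec Boolₚ._≟_ bs′ bs
  ... | no neq   = inj₂ (trans (sym (insert-other bs bs′ s t neq)) eq)
  ... | yes refl with insert-same bs s t
  ...   | s″ , eq′ , origin , _ with just-injective (trans (sym eq) eq′)
  ...     | refl with origin
  ...       | inj₁ e = inj₁ (refl , e)
  ...       | inj₂ e = inj₂ e

  insert-improves : ∀ (bs bs′ : Vec Bool k) (s : State n) t {o} → find bs′ t ≡ just o →
    ∃[ s′ ] (find bs′ (insert bs s t) ≡ just s′ × cst s′ ≤ᴿ cst o)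
  insert-improves bs bs′ s t {o} eq with Vecₚ.≡-dec Boolₚ._≟_ bs′ bs
  ... | no neq   = o , trans (insert-other bs bs′ s t neq) eq , ≤ᴿ-refl {cst o}
  ... | yes refl with s′ , eq′ , _ , _ , better ← insert-same bs s t = s′ , eq′ , better eq

  module _ {n} {G : Graph (suc n)} (w : EdgeWeights G) where
    open Search _≤?ᴿ_ w
    open HeldKarp _≤?ᴿ_ w

    Extends : Fin (suc n) → State (suc n) → Set
    Extends v s = adj G v (head₀ (vs s)) ≡ true × lookup (bits s) v ≡ false

    collect-sound : ∀ v ss bs {s} → find bs (collect v ss) ≡ just s →
      bits s ≡ bs × ∃[ s₀ ] (s₀ ∈ ss × Extends v s₀ × s ≡ extend w v s₀)
    collect-sound v [] bs eq with () ← trans (sym eq) (find-empty bs)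
    collect-sound v (s₀ ∷ ss) bs eq
      with adj G v (head₀ (vs s₀)) in edge | lookup (bits s₀) v in unused
    ... | false | _ with b , s₁ , s₁∈ , rest ← collect-sound v ss bs eq =
      b , s₁ , there s₁∈ , rest
    ... | true | true with b , s₁ , s₁∈ , rest ← collect-sound v ss bs eq =
      b , s₁ , there s₁∈ , rest
    ... | true | false
      with insert-⁻ (bits (extend w v s₀)) bs (extend w v s₀) (collect v ss) eq
    ...   | inj₁ (refl , refl) = refl , s₀ , here refl , (edge , unused) , refl
    ...   | inj₂ eq′ with b , s₁ , s₁∈ , rest ← collect-sound v ss bs eq′ =
      b , s₁ , there s₁∈ , rest

    collect-improves : ∀ v s ss bs {o} → find bs (collect v ss) ≡ just o →
      ∃[ s′ ] (find bs (collect v (s ∷ ss)) ≡ just s′ × cst s′ ≤ᴿ cst o)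
    collect-improves v s ss bs {o} eq with adj G v (head₀ (vs s)) | lookup (bits s) v
    ... | false | _     = o , eq , ≤ᴿ-refl {cst o}
    ... | true  | true  = o , eq , ≤ᴿ-refl {cst o}
    ... | true  | false =
      insert-improves (bits (extend w v s)) bs (extend w v s) (collect v ss) eq

    collect-complete : ∀ v ss {s₀} → s₀ ∈ ss → Extends v s₀ →
      ∃[ s ] (find (bits (extend w v s₀)) (collect v ss) ≡ just s × cst s ≤ᴿ cst (extend w v s₀))
    collect-complete v (s₀ ∷ ss) (here refl) (edge , unused)
      rewrite edge | unused
      with s , eq , _ , better , _ ←
        insert-same (bits (extend w v s₀)) (extend w v s₀) (collect v ss)
      = s , eq , better
    collect-complete v (s₁ ∷ ss) {s₀} (there s₀∈) ext
      with s , eq , s≤ ← collect-complete v ss s₀∈ ext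
      with s′ , eq′ , s′≤ ← collect-improves v s₁ ss (bits (extend w v s₀)) eq
      = s′ , eq′ , ≤ᴿ-trans {cst s′} {cst s} {cst (extend w v s₀)} s′≤ s≤

    ∈-advance⁻ : ∀ ss us {s} → s ∈ advance ss us →
      ∃₂ λ v bs → v ∈ us × find bs (collect v ss) ≡ just s
    ∈-advance⁻ ss (v ∷ us) s∈ with ∈-flatten⁻ (collect v ss) (advance ss us) s∈
    ... | inj₁ (bs , eq) = v , bs , here refl , eq
    ... | inj₂ s∈′ with u , bs , u∈ , eq ← ∈-advance⁻ ss us s∈′ = u , bs , there u∈ , eq

    ∈-advance⁺ : ∀ ss us {s v} bs → v ∈ us → find bs (collect v ss) ≡ just s → s ∈ advance ss us
    ∈-advance⁺ ss (v ∷ us) bs (here refl) eq = ∈-flatten⁺ˡ bs (collect v ss) eq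
    ∈-advance⁺ ss (u ∷ us) bs (there v∈)  eq =
      ∈-flatten⁺ʳ (collect u ss) (∈-advance⁺ ss us bs v∈ eq)

    length-advance : ∀ ss us g →
      (∀ v bs {s} → find bs (collect v ss) ≡ just s → 1 ≤ g bs) →
      length (advance ss us) ≤ length us * sumV g
    length-advance ss []       g h = z≤n
    length-advance ss (v ∷ us) g h = ≤-trans
      (length-flatten (collect v ss) (advance ss us) g (h v))
      (+-monoʳ-≤ (sumV g) (length-advance ss us g h))

    -- The exhaustive search, in which no walk is ever discarded; the layers are measured against
    -- it.
    data Reach : ℕ → State (suc n) → Set where
      initial : Reach 0 start
      step    : ∀ {i} s v → Reach i s → Extends v s → Reach (suc i) (extend w v s)

    -- The exchange argument rests on this relation: the admissible extensions and the weights they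
    -- add depend only on the set and the head, so domination survives every extension.
    Dominated : List (State (suc n)) → State (suc n) → Set
    Dominated ss s = ∃[ s′ ]
      (s′ ∈ ss × bits s′ ≡ bits s × head₀ (vs s′) ≡ head₀ (vs s) × cst s′ ≤ᴿ cst s)

    Layer : ℕ → List (State (suc n)) → Set
    Layer i ss = (∀ {s} → s ∈ ss → Reach i s) × (∀ {s} → Reach i s → Dominated ss s)

    advance-sound : ∀ {i ss} us → Layer i ss → ∀ {s} → s ∈ advance ss us → Reach (suc i) s
    advance-sound {i} {ss} us (sound , _) s∈ =
      let v , bs , _ , eq = ∈-advance⁻ ss us s∈
          _ , s₀ , s₀∈ , ext , s≡ = collect-sound v ss bs eq
      in subst (Reach (suc i)) (sym s≡) (step s₀ v (sound s₀∈) ext)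

    advance-complete : ∀ {i ss} us → Layer i ss → ∀ {s v} → v ∈ us → Reach i s → Extends v s →
      Dominated (advance ss us) (extend w v s)
    advance-complete {i} {ss} us (_ , complete) {s} {v} v∈ r (edge , unused) =
      let s₀ , s₀∈ , bits≡ , head≡ , s₀≤ = complete r
          s′ , eq , s′≤ = collect-complete v ss s₀∈
            (trans (cong (adj G v) head≡) edge , trans (cong (λ b → lookup b v) bits≡) unused)
          bits≡′ , _ , _ , _ , s≡ = collect-sound v ss (bits (extend w v s₀)) eq
      in s′ , ∈-advance⁺ ss us (bits (extend w v s₀)) v∈ eq
       , trans bits≡′ (cong (Vec._[ v ]≔ true) bits≡)
       , cong (λ s → head₀ (vs s)) s≡
       , ≤ᴿ-trans {cst s′} {cst (extend w v s₀)} {cst (extend w v s)} s′≤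
           (subst (λ u → (c w v (head₀ (vs s₀)) +ᴿ cst s₀) ≤ᴿ (c w v u +ᴿ cst s)) head≡
             (+ᴿ-monoʳ-≤ (c w v (head₀ (vs s₀))) {cst s₀} {cst s} s₀≤))

    advance-layer : ∀ {i ss} → Layer i ss → Layer (suc i) (advance ss (allFin (suc n)))
    advance-layer layer = advance-sound (allFin (suc n)) layer , λ where
      (step s v r ext) → advance-complete (allFin (suc n)) layer {s} {v} (∈-allFin v) r ext

    layers-layer : ∀ j i ss → Layer i ss → Layer (j + i) (layers ss j)
    layers-layer zero    i ss layer = layer
    layers-layer (suc j) i ss layer =
      subst (λ m → Layer m (layers ss (suc j))) (+-suc j i)
        (layers-layer j (suc i) (advance ss (allFin (suc n))) (advance-layer layer))

    start-layer : Layer 0 (start ∷ [])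
    start-layer = (λ { (here refl) → initial }) , λ where
      initial → start , here refl , refl , refl , ≤ᴿ-refl {0ᴿ}

    layer : ∀ i → Layer i (layers (start ∷ []) i)
    layer i = subst (λ m → Layer m (layers (start ∷ []) i)) (+-identityʳ i)
      (layers-layer i 0 (start ∷ []) start-layer)

    -- The outer `suc` accommodates layer 0, whose single state is not covered by `g`. A later layer
    -- comes from `suc n` tries, one for each added vertex.
    length-layers : ∀ g → (∀ {i s} → Reach (suc i) s → 1 ≤ g (bits s)) →
      ∀ i → length (layers (start ∷ []) i) ≤ suc (suc n * sumV g)
    length-layers g h zero    = s≤s z≤n
    length-layers g h (suc i) = go i (start ∷ []) 0 start-layer
      where
      go : ∀ i ss j → Layer j ss → length (layers ss (suc i)) ≤ suc (suc n * sumV g)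
      go (suc i) ss j l = go i (advance ss (allFin (suc n))) (suc j) (advance-layer l)
      go zero    ss j l = m≤n⇒m≤1+n (≤-trans
        (length-advance ss (allFin (suc n)) g λ v bs eq →
          let bits≡ , s₀ , s₀∈ , ext , s≡ = collect-sound v ss bs eq in
          subst (λ b → 1 ≤ g b) bits≡
            (subst (λ s → 1 ≤ g (bits s)) (sym s≡) (h (step s₀ v (proj₁ l s₀∈) ext))))
        (≤-reflexive (cong (_* sumV g) (length-allFin (suc n)))))

-- Hamiltonian cycles

lookup-replicate-false : ∀ (u : Fin n) → lookup (zerosVec n) u ≡ false
lookup-replicate-false u = Vecₚ.lookup-replicate u false

lookup-injective : ∀ {A : Set} (xs ys : Vec A n) → (∀ u → lookup xs u ≡ lookup ys u) → xs ≡ ys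
lookup-injective xs ys h = trans (sym (Vecₚ.tabulate∘lookup xs))
  (trans (Vecₚ.tabulate-cong h) (Vecₚ.tabulate∘lookup ys))

∋≡-∷ : ∀ (X : Vec Bool n) {us} v → X ∋≡ us → (X Vec.[ v ]≔ true) ∋≡ (v ∷ us)
∋≡-∷ X v h u with u Finₚ.≟ v
... | yes refl = (λ _ → here refl) , λ _ → Vecₚ.lookup∘update v X true
... | no  u≢v  =
  (λ eq → there (proj₁ (h u) (trans (sym (Vecₚ.lookup∘update′ u≢v X true)) eq))) ,
  λ { (here u≡v)  → contradiction u≡v u≢v
    ; (there u∈) → trans (Vecₚ.lookup∘update′ u≢v X true) (proj₂ (h u) u∈) }

∋≡-∉ : ∀ (X : Vec Bool n) {us v} → X ∋≡ us → lookup X v ≡ false → v ∉ us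
∋≡-∉ X {v = v} h eq v∈ with () ← trans (sym eq) (proj₂ (h v) v∈)

∋≡-false : ∀ (X : Vec Bool n) {us v} → X ∋≡ us → v ∉ us → lookup X v ≡ false
∋≡-false X {v = v} h v∉ with lookup X v in eq
... | false = refl
... | true  = contradiction (proj₁ (h v) eq) v∉

spanning : ∀ {vs : List (Fin n)} → Unique vs → length vs ≡ n → ∀ v → v ∈ vs
spanning {n} {vs} u len v with v ∈? vs
... | yes v∈ = v∈
... | no  v∉ = contradiction
  (≤-trans (length-⊆ {xs = v ∷ vs} {allFin n} (All.tabulate (λ { x∈ refl → v∉ x∈ }) ∷ u)
      λ {x} _ → ∈-allFin x)
    (≤-reflexive (trans (length-allFin n) (sym len))))
  (<-irrefl refl)

unique-length≤ : ∀ {vs : List (Fin n)} → Unique vs → length vs ≤ n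
unique-length≤ {n} {vs} u = ≤-trans (length-⊆ {ys = allFin n} u λ {x} _ → ∈-allFin x)
  (≤-reflexive (length-allFin n))

-- The part of `HamiltonianCycle` that is carried through a rotation; the length is tracked
-- separately.
record Closed {n} (G : Graph n) (vs : List (Fin n)) : Set where
  field
    unique : Unique vs
    linked : Linked (Adj G) (closeUp vs)

module _ {n} {G : Graph n} where

  linked-∷ʳ : ∀ xs {a b} → Linked (Adj G) (xs ∷ʳ a) → Adj G a b → Linked (Adj G) (xs ∷ʳ a ∷ʳ b)
  linked-∷ʳ []           _        e = e ∷ [-]
  linked-∷ʳ (x ∷ [])     (e′ ∷ _) e = e′ ∷ e ∷ [-]
  linked-∷ʳ (x ∷ y ∷ xs) (e′ ∷ l) e = e′ ∷ linked-∷ʳ (y ∷ xs) l e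

  linked-init : ∀ xs {a} → Linked (Adj G) (xs ∷ʳ a) → Linked (Adj G) xs
  linked-init []           _       = []
  linked-init (x ∷ [])     _       = [-]
  linked-init (x ∷ y ∷ xs) (e ∷ l) = e ∷ linked-init (y ∷ xs) l

  hamiltonian-length : ∀ {vs} → HamiltonianCycle G vs → length vs ≡ n
  hamiltonian-length {vs} H = ≤-antisym (unique-length≤ distinct)
    (≤-trans (≤-reflexive (sym (length-allFin n)))
      (length-⊆ (Uniqueₚ.allFin⁺ n) λ {x} _ → covers x))
    where open HamiltonianCycle H

  module _ (w : EdgeWeights G) where

    -- Equality of the representing sequences, which is stronger than _≈ᴿ_.
    SameWeight : List (Fin n) → List (Fin n) → Set
    SameWeight us vs = ∀ k → seq (cycleWeight w us) k ≡ seq (cycleWeight w vs) k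

    walkWeight-∷ʳ : ∀ xs a b k →
      seq (walkWeight w (xs ∷ʳ a ∷ʳ b)) k ≡ seq (walkWeight w (xs ∷ʳ a)) k ℚ.+ seq (c w a b) k
    walkWeight-∷ʳ []           a b k = ℚₚ.+-comm (seq (c w a b) k) ℚ.0ℚ
    walkWeight-∷ʳ (x ∷ [])     a b k = trans (cong (seq (c w x a) k ℚ.+_) (walkWeight-∷ʳ [] a b k))
      (sym (ℚₚ.+-assoc (seq (c w x a) k) ℚ.0ℚ (seq (c w a b) k)))
    walkWeight-∷ʳ (x ∷ y ∷ xs) a b k = trans
      (cong (seq (c w x y) k ℚ.+_) (walkWeight-∷ʳ (y ∷ xs) a b k))
      (sym (ℚₚ.+-assoc (seq (c w x y) k) (seq (walkWeight w ((y ∷ xs) ∷ʳ a)) k) (seq (c w a b) k)))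

    -- The first edge of the closed walk becomes its last edge, and nothing else changes.
    rotate₁ : ∀ v xs → Closed G (v ∷ xs) → Closed G (xs ∷ʳ v) × SameWeight (xs ∷ʳ v) (v ∷ xs)
    rotate₁ v []       H = H , λ _ → refl
    rotate₁ v (x ∷ xs) record { unique = v∉ ∷ u ; linked = e ∷ l } =
      record
        { unique = Uniqueₚ.++⁺ u ([] ∷ []) λ { (y∈ , here refl) → All.lookup v∉ y∈ refl }
        ; linked = linked-∷ʳ (x ∷ xs) l e
        } ,
      λ k → trans (walkWeight-∷ʳ (x ∷ xs) v x k)
        (ℚₚ.+-comm (seq (walkWeight w ((x ∷ xs) ∷ʳ v)) k) (seq (c w v x) k))

    rotate : ∀ {z} as bs → Closed G (as ++ z ∷ bs) → ∃[ us ]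
      (Closed G (z ∷ us) × length (z ∷ us) ≡ length (as ++ z ∷ bs) ×
       SameWeight (z ∷ us) (as ++ z ∷ bs))
    rotate []       bs H = bs , H , refl , λ _ → refl
    rotate {z} (a ∷ as) bs H
      with H₁ , same₁ ← rotate₁ a (as ++ z ∷ bs) H
      rewrite Listₚ.++-assoc as (z ∷ bs) (a ∷ [])
      with us , H₂ , len , same₂ ← rotate as (bs ∷ʳ a) H₁
      = us , H₂ , trans len (trans (cong length (sym (Listₚ.++-assoc as (z ∷ bs) (a ∷ []))))
                              (Listₚ.length-++-comm (as ++ z ∷ bs) (a ∷ [])))
      , λ k → trans (same₂ k) (same₁ k)

module _ (_≤?ᴿ_ : Decidable _≤ᴿ_) {n} {G : Graph (suc n)} (w : EdgeWeights G) where
  open HeldKarp _≤?ᴿ_ w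
  open Search _≤?ᴿ_ w

  ∷-linked : ∀ {v} us → Adj G v (head₀ us) → Linked (Adj G) (us ∷ʳ zero) →
             Linked (Adj G) (v ∷ us ∷ʳ zero)
  ∷-linked []      e l = e ∷ l
  ∷-linked (_ ∷ _) e l = e ∷ l

  head-adjacent : ∀ {v} us → Linked (Adj G) (v ∷ us ∷ʳ zero) → Adj G v (head₀ us)
  head-adjacent []      (e ∷ _) = e
  head-adjacent (_ ∷ _) (e ∷ _) = e

  walkWeight-∷ : ∀ v us k →
    seq (c w v (head₀ us)) k ℚ.+ seq (walkWeight w (us ∷ʳ zero)) k ≡
    seq (walkWeight w (v ∷ us ∷ʳ zero)) k
  walkWeight-∷ v []      k = refl
  walkWeight-∷ v (_ ∷ _) k = refl

  record Path (s : State (suc n)) (i : ℕ) : Set where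
    field
      unique  : Unique (vs s)
      linked  : Linked (Adj G) (vs s ∷ʳ zero)
      visited : bits s ∋≡ vs s
      size    : length (vs s) ≡ i
      weighs  : ∀ k → seq (cst s) k ≡ seq (walkWeight w (vs s ∷ʳ zero)) k

  reach-path : ∀ {i s} → Reach _≤?ᴿ_ w i s → Path s i
  reach-path initial = record
    { unique  = []
    ; linked  = [-]
    ; visited = λ u → (λ eq → contradiction (trans (sym eq) (lookup-replicate-false u)) λ ()) , λ ()
    ; size    = refl
    ; weighs  = λ _ → refl
    }
  reach-path (step s v r (edge , unused)) = record
    { unique  = All.tabulate (λ { x∈ refl → ∋≡-∉ (bits s) P.visited unused x∈ }) ∷ P.unique
    ; linked  = ∷-linked (vs s) (Equivalence.from T-≡ edge) P.linked
    ; visited = ∋≡-∷ (bits s) v P.visited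
    ; size    = cong suc P.size
    ; weighs  = λ k → trans (cong (seq (c w v (head₀ (vs s))) k ℚ.+_) (P.weighs k))
                        (walkWeight-∷ v (vs s) k)
    }
    where
    module P = Path (reach-path r)

  path-reach : ∀ us → Unique us → Linked (Adj G) (us ∷ʳ zero) →
    ∃[ s ] (Reach _≤?ᴿ_ w (length us) s × vs s ≡ us)
  path-reach []       _        _ = start , initial , refl
  path-reach (v ∷ us) (v∉ ∷ u) l
    with s , r , refl ← path-reach us u (Linked.tail l)
    = extend w v s
    , step s v r ( Equivalence.to T-≡ (head-adjacent us l)
                 , ∋≡-false (bits s) (Path.visited (reach-path r)) λ v∈ → All.lookup v∉ v∈ refl)
    , refl

  closing : List (State (suc n))
  closing = advance (layers (start ∷ []) n) (zero ∷ [])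

  -- Every closing state was extended by vertex 0 last and visits as many distinct vertices as there
  -- are, so its set is full. All of them thus sit at one key of one trie, and the program may
  -- return the first without a final minimisation.
  closing-unique : ∀ {s s′} → s ∈ closing → s′ ∈ closing → s ≡ s′
  closing-unique {s} {s′} s∈ s′∈ =
    let v  , bs  , v∈  , eq  = ∈-advance⁻ _≤?ᴿ_ w ss (zero ∷ []) s∈
        v′ , bs′ , v′∈ , eq′ = ∈-advance⁻ _≤?ᴿ_ w ss (zero ∷ []) s′∈
        bits≡  , _ = collect-sound _≤?ᴿ_ w v ss bs eq
        bits≡′ , _ = collect-sound _≤?ᴿ_ w v′ ss bs′ eq′
        bs≡ = trans (sym bits≡) (trans (lookup-injective (bits s) (bits s′) λ u →
                trans (full s∈ u) (sym (full s′∈ u))) bits≡′)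
    in just-injective (trans (sym eq) (trans
         (cong₂ (λ b v → find b (collect v ss)) bs≡
           (trans (singleton⁻ v∈) (sym (singleton⁻ v′∈)))) eq′))
    where
    ss = layers (start ∷ []) n
    full : ∀ {s} → s ∈ closing → ∀ u → lookup (bits s) u ≡ true
    full s∈ u = proj₂ (visited u) (spanning unique size u)
      where open Path (reach-path (advance-sound _≤?ᴿ_ w (zero ∷ []) (layer _≤?ᴿ_ w n) s∈))

  closing-cycle : 3 ≤ suc n → ∀ {s} → s ∈ closing →
    ∃[ us ] (vs s ≡ zero ∷ us × HamiltonianCycle G (zero ∷ us) ×
      cycleWeight w (zero ∷ us) ≤ᴿ cst s)
  closing-cycle 3≤ {s} s∈ =
    let v , bs , v∈ , eq = ∈-advance⁻ _≤?ᴿ_ w ss (zero ∷ []) s∈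
        _ , s₀ , _ , _ , s≡ = collect-sound _≤?ᴿ_ w v ss bs eq
        vs≡ = trans (cong vs s≡) (cong (_∷ vs s₀) (singleton⁻ v∈))
    in vs s₀ , vs≡ , subst (HamiltonianCycle G) vs≡ (record
         { length≥3 = subst (3 ≤_) (sym size) 3≤
         ; distinct = unique
         ; covers   = spanning unique size
         ; adjacent =
             subst (Linked (Adj G)) (trans (cong (_∷ʳ zero) vs≡) (cong closeUp (sym vs≡))) linked
         }) , ≤ᴿ-pointwise {cycleWeight w (zero ∷ vs s₀)} {cst s} λ k →
           sym (trans (weighs k) (cong (λ us → seq (walkWeight w (us ∷ʳ zero)) k) vs≡))
    where
    ss = layers (start ∷ []) n
    open Path (reach-path (advance-sound _≤?ᴿ_ w (zero ∷ []) (layer _≤?ᴿ_ w n) s∈))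

  closing-complete₀ : ∀ us → Closed G (zero ∷ us) → length us ≡ n →
    ∃[ t ] (t ∈ closing × cst t ≤ᴿ cycleWeight w (zero ∷ us))
  closing-complete₀ us C len =
    let s , r , vs≡ = path-reach us (Unique.tail unique) (Linked.tail linked)
        module P = Path (reach-path r)
        extends = trans (cong (λ us → adj G zero (head₀ us)) vs≡)
                        (Equivalence.to T-≡ (head-adjacent us linked))
                , ∋≡-false (bits s) P.visited
                    (subst (zero ∉_) (sym vs≡) (Uniqueₚ.Unique[x∷xs]⇒x∉xs unique))
        t , t∈ , _ , _ , t≤ = advance-complete _≤?ᴿ_ w (zero ∷ []) (layer _≤?ᴿ_ w n) {s} {zero}
          (here refl) (subst (λ i → Reach _≤?ᴿ_ w i s) len r) extends
    in t , t∈ , ≤ᴿ-trans {cst t} {c w zero (head₀ (vs s)) +ᴿ cst s} {cycleWeight w (zero ∷ us)} t≤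
         (≤ᴿ-pointwise {c w zero (head₀ (vs s)) +ᴿ cst s} {cycleWeight w (zero ∷ us)} λ k →
           trans (cong (seq (c w zero (head₀ (vs s))) k ℚ.+_) (P.weighs k))
             (trans (walkWeight-∷ zero (vs s) k)
               (cong (λ us → seq (cycleWeight w (zero ∷ us)) k) vs≡)))
    where open Closed C

  -- The search sees cycles only as lists that begin with vertex 0, so the given cycle is first
  -- rotated to that form.
  closing-complete : ∀ {us} → HamiltonianCycle G us →
    ∃[ s ] (s ∈ closing × cst s ≤ᴿ cycleWeight w us)
  closing-complete {us} H =
    let as , bs , us≡ = ∈-∃++ (covers zero)
        C₀ = record { unique = distinct ; linked = adjacent }
        xs , C , len , same = rotate w as bs (subst (Closed G) us≡ C₀)
        t , t∈ , t≤ = closing-complete₀ xs C (suc-injective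
          (trans len (trans (cong length (sym us≡)) (hamiltonian-length H))))
    in t , t∈ , ≤ᴿ-trans {cst t} {cycleWeight w (zero ∷ xs)} {cycleWeight w us} t≤
         (≤ᴿ-pointwise {cycleWeight w (zero ∷ xs)} {cycleWeight w us} λ k →
           trans (same k) (cong (λ us → seq (cycleWeight w us) k) (sym us≡)))
    where open HamiltonianCycle H

  closing-correct : 3 ≤ suc n → TSPAnswer G w (firstPath closing)
  closing-correct 3≤ = go closing refl
    where
    go : ∀ ss → closing ≡ ss → TSPAnswer G w (firstPath ss)
    go [] eq = noCycle λ us H →
      let s , s∈ , _ = closing-complete H in contradiction (subst (s ∈_) eq s∈) λ ()
    go (s ∷ ss) eq =
      let s∈ = subst (s ∈_) (sym eq) (here refl)
          us , vs≡ , H , ≤cst = closing-cycle 3≤ s∈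
      in subst (λ us → TSPAnswer G w (encodeList encodeFin us)) (sym vs≡)
           (optimal (zero ∷ us) H λ us′ H′ →
             let s′ , s′∈ , s′≤ = closing-complete H′
             in ≤ᴿ-trans {cycleWeight w (zero ∷ us)} {cst s} {cycleWeight w us′} ≤cst
                  (subst (λ s → cst s ≤ᴿ cycleWeight w us′) (closing-unique s′∈ s∈) s′≤))

-- Exponents and the total cost

^-cancelˡ-≤ : ∀ b {x y} → x ^ suc b ≤ y ^ suc b → x ≤ y
^-cancelˡ-≤ b {x} {y} h = ≮⇒≥ λ y<x → <⇒≱ (^-monoˡ-< (suc b) y<x) h

fraction-≤ : ∀ {a b p q} → mkℚᵘ (+ a) b ℚᵘ.≤ mkℚᵘ (+ p) q → a * suc q ≤ p * suc b
fraction-≤ {a} {b} {p} {q} (*≤* h) =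
  ℤₚ.drop‿+≤+ (subst₂ ℤ._≤_ (sym (ℤₚ.pos-* a (suc q))) (sym (ℤₚ.pos-* p (suc b))) h)

fraction-≰ : ∀ {a b p q} → ¬ (mkℚᵘ (+ a) b ℚᵘ.≤ mkℚᵘ -[1+ p ] q)
fraction-≰ {a} {b} {p} {q} (*≤* h)
  with () ← subst (ℤ._≤ -[1+ p ] ℤ.* + suc b) (sym (ℤₚ.pos-* a (suc q))) h

toℚᵘ-/ : ∀ p q → toℚᵘ (+ p ℚ./ suc q) ℚᵘ.≃ mkℚᵘ (+ p) q
toℚᵘ-/ p q = ℚₚ.toℚᵘ-fromℚᵘ (mkℚᵘ (+ p) q)

fromℚ-≤ : ∀ {x p q} → (∀ k → seq x k ≡ p) → x ≤ᴿ fromℚ q → p ℚ.≤ q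
fromℚ-≤ {x} {p} {q} const h = ℚₚ.≮⇒≥ λ q<p →
  let δ = ½ ℚ.* (p ℚ.- q)
      0<δ = 0<½* (subst (ℚ._< p ℚ.- q) (ℚₚ.+-inverseʳ q) (ℚₚ.+-monoˡ-< (ℚ.- q) q<p))
      N , le = h δ 0<δ
      p≤ = subst (ℚ._≤ q ℚ.+ δ) (const N) (le N ≤-refl)
  in ℚₚ.<-irrefl refl (begin-strict
       p                   ≤⟨ p≤ ⟩
       q ℚ.+ δ             ≡⟨ ℚₚ.+-identityʳ (q ℚ.+ δ) ⟨
       q ℚ.+ δ ℚ.+ 0ℚ      <⟨ ℚₚ.+-monoʳ-< (q ℚ.+ δ) 0<δ ⟩
       q ℚ.+ δ ℚ.+ δ
         ≡⟨ solve 2 (λ p q → q :+ con ½ :* (p :- q) :+ con ½ :* (p :- q) := p) refl p q ⟩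
       p                   ∎)
  where
  open ℚₚ.≤-Reasoning
  open +-*-Solver

cross-multiplied : ∀ s m →
  ((+ 1 ℤ.* s ℤ.+ ℤ.- + 1 ℤ.* + 1) ℤ.* s ℤ.+ m ℤ.* (+ 1 ℤ.* s)) ℤ.* s ≡
  ((s ℤ.- + 1) ℤ.+ m) ℤ.* (+ 1 ℤ.* s ℤ.* s)
cross-multiplied = ℤSolver.solve-∀

one-minus : ∀ b m → mkℚᵘ (+ 1) 0 ℚᵘ.- mkℚᵘ (+ 1) b ℚᵘ.+ mkℚᵘ (+ m) b ℚᵘ.≃ mkℚᵘ (+ (b + m)) b
one-minus b m = *≡* (cross-multiplied (+ suc b) (+ m))

1-q : ∀ b q → toℚᵘ q ℚᵘ.≃ mkℚᵘ (+ 1) b →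
  toℚᵘ (1ℚ ℚ.- q) ℚᵘ.≃ mkℚᵘ (+ 1) 0 ℚᵘ.- mkℚᵘ (+ 1) b
1-q b q q≃ = ℚᵘₚ.≃-trans (ℚₚ.toℚᵘ-homo-+ 1ℚ (ℚ.- q))
  (ℚᵘₚ.+-congʳ (mkℚᵘ (+ 1) 0)
    (ℚᵘₚ.≃-trans (ℚₚ.toℚᵘ-homo‿- q) (ℚᵘₚ.-‿cong {toℚᵘ q} {mkℚᵘ (+ 1) b} q≃)))

module _ (b : ℕ) (x : ℝ)
  (x≃ : ∀ k → toℚᵘ (seq x k) ℚᵘ.≃ mkℚᵘ (+ 1) 0 ℚᵘ.- mkℚᵘ (+ 1) b) where

  ·ᴿ-fraction : ∀ n k → toℚᵘ (seq (n ·ᴿ x) k) ℚᵘ.≃ mkℚᵘ (+ (b * n)) b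
  ·ᴿ-fraction zero    k = *≡* (trans (ℤₚ.*-zeroˡ (+ suc b))
    (sym (trans (cong (λ m → + m ℤ.* + 1) (*-zeroʳ b)) (ℤₚ.*-zeroˡ (+ 1)))))
  ·ᴿ-fraction (suc n) k = ℚᵘₚ.≃-trans (ℚₚ.toℚᵘ-homo-+ (seq x k) (seq (n ·ᴿ x) k))
    (ℚᵘₚ.≃-trans
      (ℚᵘₚ.+-cong {toℚᵘ (seq x k)} {mkℚᵘ (+ 1) 0 ℚᵘ.- mkℚᵘ (+ 1) b}
        {toℚᵘ (seq (n ·ᴿ x) k)} {mkℚᵘ (+ (b * n)) b} (x≃ k) (·ᴿ-fraction n k))
      (ℚᵘₚ.≃-trans (one-minus b (b * n))
        (ℚᵘₚ.≃-reflexive (cong (λ m → mkℚᵘ (+ m) b) (sym (*-suc b n))))))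

  ·ᴿ-constant : ∀ n k → seq (n ·ᴿ x) k ≡ seq (n ·ᴿ x) 0
  ·ᴿ-constant n k = ℚₚ.toℚᵘ-injective
    (ℚᵘₚ.≃-trans (·ᴿ-fraction n k) (ℚᵘₚ.≃-sym (·ᴿ-fraction n 0)))

  ·ᴿ-≤ : ∀ n r → (n ·ᴿ x) ≤ᴿ fromℚ r → mkℚᵘ (+ (b * n)) b ℚᵘ.≤ toℚᵘ r
  ·ᴿ-≤ n r h = ℚᵘₚ.≤-respˡ-≃ (·ᴿ-fraction n 0)
    (ℚₚ.toℚᵘ-mono-≤ (fromℚ-≤ {n ·ᴿ x} {seq (n ·ᴿ x) 0} {r} (·ᴿ-constant n) h))

  -- The exponent equals b n / (b + 1). For a rational p / q above it, both sides are compared after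
  -- raising to the power b + 1, where cross-multiplication compares the exponents of 2, and the
  -- root is taken at the end. A negative rational cannot lie above it.
  ≤·2^-intro : ∀ n t B → t ^ suc b ≤ B ^ suc b * 2 ^ (b * n) → t ≤ B ·2^ (n ·ᴿ x)
  ≤·2^-intro n t B h r@(mkℚ -[1+ p ] q-1 _) n·x≤r =
    contradiction (·ᴿ-≤ n r n·x≤r) (fraction-≰ {b * n} {b} {p} {q-1})
  ≤·2^-intro n t B h r@(mkℚ (+ p) q-1 _) n·x≤r = ^-cancelˡ-≤ b (begin
    (t ^ q) ^ suc b                         ≡⟨ ^-swap t q (suc b) ⟩
    (t ^ suc b) ^ q                         ≤⟨ ^-monoˡ-≤ q h ⟩
    (B ^ suc b * 2 ^ (b * n)) ^ q           ≡⟨ ^-distribʳ-* (B ^ suc b) (2 ^ (b * n)) q ⟩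
    (B ^ suc b) ^ q * (2 ^ (b * n)) ^ q
      ≡⟨ cong₂ _*_ (^-swap B (suc b) q) (^-*-assoc 2 (b * n) q) ⟩
    (B ^ q) ^ suc b * 2 ^ (b * n * q)
      ≤⟨ *-monoʳ-≤ ((B ^ q) ^ suc b)
           (^-monoʳ-≤ 2 (fraction-≤ {b * n} {b} {p} {q-1} (·ᴿ-≤ n r n·x≤r))) ⟩
    (B ^ q) ^ suc b * 2 ^ (p * suc b)       ≡⟨ cong ((B ^ q) ^ suc b *_) (^-*-assoc 2 p (suc b)) ⟨
    (B ^ q) ^ suc b * (2 ^ p) ^ suc b       ≡⟨ ^-distribʳ-* (B ^ q) (2 ^ p) (suc b) ⟨
    (B ^ q * 2 ^ p) ^ suc b                 ∎)
    where
    open ≤-Reasoning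
    q = suc q-1

private
  0<1 : 0ℚ ℚ.< 1ℚ
  0<1 = ℚₚ.positive⁻¹ 1ℚ

-- One 1 absorbs the variation of the sequence beyond its modulus, the other the tolerance in
-- `_≤ᴿ_`.
eventual-bound : ℝ → ℚ
eventual-bound d = seq d (proj₁ (cauchy d 1ℚ 0<1)) ℚ.+ 1ℚ ℚ.+ 1ℚ

fromℚ≤eventual-bound : ∀ q d → fromℚ q ≤ᴿ d → q ℚ.≤ eventual-bound d
fromℚ≤eventual-bound q d h with cauchy d 1ℚ 0<1 | h 1ℚ 0<1
... | N , p | N′ , le = begin
  q                         ≤⟨ le (N + N′) (m≤n+m N′ N) ⟩
  seq d (N + N′) ℚ.+ 1ℚ
    ≤⟨ ℚₚ.+-monoˡ-≤ 1ℚ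
         (∣p-q∣≤δ⇒p≤q+δ (seq d (N + N′)) (seq d N) (p (N + N′) N (m≤m+n N N′) ≤-refl)) ⟩
  seq d N ℚ.+ 1ℚ ℚ.+ 1ℚ     ∎
  where open ℚₚ.≤-Reasoning

/-≤ : ∀ s n r → + s ℚ./ suc n ℚ.≤ r → s ≤ ℤ.∣ ↥ r ∣ * suc n
/-≤ s n r h with r | ℚᵘₚ.≤-respˡ-≃ (toℚᵘ-/ s n) (ℚₚ.toℚᵘ-mono-≤ h)
... | mkℚ -[1+ p ] q _ | h′ = contradiction h′ (fraction-≰ {s} {n} {p} {q})
... | mkℚ (+ p) q _    | h′ = ≤-trans (m≤m*n s (suc q)) (fraction-≤ {s} {n} {p} {q} h′)

-- The counting needs an integer; as denominators are at least 1, the numerator bounds a nonnegative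
-- fraction.
degreeBound : ℝ → ℕ
degreeBound d = ℤ.∣ ↥ eventual-bound d ∣

degree-sum : ∀ d n (G : Graph (suc n)) → fromℚ (averageDegree G) ≤ᴿ d →
  sum (map (deg G) (allFin (suc n))) ≤ degreeBound d * suc n
degree-sum d n G h = /-≤ (sum (map (deg G) (allFin (suc n)))) n (eventual-bound d)
  (fromℚ≤eventual-bound (averageDegree G) d h)

module _ (_≤?ᴿ_ : Decidable _≤ᴿ_) {n} {G : Graph (3 + n)} (w : EdgeWeights G) (M : ℕ) where
  open HeldKarp _≤?ᴿ_ w
  open Search _≤?ᴿ_ w

  private
    N S X Q Λ : ℕ
    N = 3 + n
    S = suc N
    X = S * unit
    Q = suc M
    -- The bound of `length-layers`, with `M` in place of the sum over vertex sets.
    Λ = suc (N * M)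

    1≤unit : 1 ≤ unit
    1≤unit = ≤unit 1

    1≤X : 1 ≤ X
    1≤X = *-mono-≤ {1} {S} (s≤s z≤n) 1≤unit

    S≤X : S ≤ X
    S≤X = ≤-trans (≤-reflexive (sym (*-identityʳ S))) (*-monoʳ-≤ S 1≤unit)

    unit≤X : unit ≤ X
    unit≤X = m≤m+n unit _

    XQ : ℕ → ℕ
    XQ i = X ^ i * Q

    1≤XQ : ∀ i → 1 ≤ XQ i
    1≤XQ i = *-mono-≤ (m^n>0 X {{>-nonZero 1≤X}} i) (s≤s (z≤n {M}))

    XQ-mono : ∀ {i j} → i ≤ j → XQ i ≤ XQ j
    XQ-mono h = *-monoˡ-≤ Q (^-monoʳ-≤ X {{>-nonZero 1≤X}} h)

    sucΛ≤ : suc Λ ≤ S * Q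
    sucΛ≤ = ≤-trans (m≤m+n _ (suc (suc n) + M)) (≤-reflexive (eq n M))
      where
      eq : ∀ n m → suc (suc ((3 + n) * m)) + (suc (suc n) + m) ≡ suc (3 + n) * suc m
      eq = solve-∀

    collectCost≤ : collectCost Λ ≤ 2 * XQ 2
    collectCost≤ = begin
      suc Λ * (unit * suc X) ≤⟨ *-mono-≤ sucΛ≤ (*-monoʳ-≤ unit (+-monoˡ-≤ X 1≤X)) ⟩
      S * Q * (unit * (X + X))        ≡⟨ eq S unit Q ⟩
      2 * XQ 2 ∎
      where
      open ≤-Reasoning
      eq : ∀ s u q → s * q * (u * (s * u + s * u)) ≡ 2 * (s * u * (s * u * 1) * q)
      eq = solve-∀

    flattenBound≤ : flattenBound Λ ≤ 2 * XQ 2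
    flattenBound≤ = begin
      unit + Λ * (S * (2 * unit))
        ≤⟨ +-monoˡ-≤ (Λ * (S * (2 * unit)))
             (≤-trans unit≤X (≤-trans (m≤n*m X 2) (≤-reflexive (eq₁ S unit)))) ⟩
      suc Λ * (S * (2 * unit)) ≤⟨ *-monoˡ-≤ (S * (2 * unit)) (≤-trans sucΛ≤ (*-monoˡ-≤ Q S≤X)) ⟩
      X * Q * (S * (2 * unit)) ≡⟨ eq S unit Q ⟩
      2 * XQ 2 ∎
      where
      open ≤-Reasoning
      eq₁ : ∀ s u → 2 * (s * u) ≡ s * (2 * u)
      eq₁ = solve-∀
      eq : ∀ s u q → s * u * q * (s * (2 * u)) ≡ 2 * (s * u * (s * u * 1) * q)
      eq = solve-∀

    advanceCost≤ : ∀ j → suc j ≤ S → advanceCost Λ j ≤ 5 * XQ 3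
    advanceCost≤ j h = begin
      suc j * (unit * suc (collectCost Λ + flattenBound Λ))
        ≤⟨ *-mono-≤ h (*-monoʳ-≤ unit (+-mono-≤ (1≤XQ 2) (+-mono-≤ collectCost≤ flattenBound≤))) ⟩
      S * (unit * (XQ 2 + (2 * XQ 2 + 2 * XQ 2))) ≡⟨ eq S unit Q ⟩
      5 * XQ 3 ∎
      where
      open ≤-Reasoning
      eq : ∀ s u q → let y = s * u * (s * u * 1) * q in
        s * (u * (y + (2 * y + 2 * y))) ≡ 5 * (s * u * (s * u * (s * u * 1)) * q)
      eq = solve-∀

    iterateCost≤ : iterateCost Λ (2 + n) ≤ 6 * XQ 4
    iterateCost≤ = begin
      N * (unit * suc (advanceCost Λ N))
        ≤⟨ *-mono-≤ (n≤1+n N) (*-monoʳ-≤ unit (+-mono-≤ (1≤XQ 3) (advanceCost≤ N ≤-refl))) ⟩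
      S * (unit * (XQ 3 + 5 * XQ 3)) ≡⟨ eq S unit Q ⟩
      6 * XQ 4 ∎
      where
      open ≤-Reasoning
      eq : ∀ s u q → let y = s * u * (s * u * (s * u * 1)) * q in
        s * (u * (y + 5 * y)) ≡ 6 * (s * u * (s * u * (s * u * (s * u * 1))) * q)
      eq = solve-∀

  -- Each level of nesting contributes one more factor `X`: power 2 for collecting, 3 for a round, 4
  -- for all rounds and 5 for the program. The coefficient is 1 + 1 + 6 + 5.
  programCost≤ : programCost _≤?ᴿ_ w Λ ≤ 13 * ((suc N * unit) ^ 5 * suc M)
  programCost≤ = begin
    unit * suc (X + iterateCost Λ (2 + n) + advanceCost Λ 1)
      ≤⟨ *-mono-≤ unit≤X (+-mono-≤ (1≤XQ 4) (+-mono-≤ (+-mono-≤ X≤ iterateCost≤)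
           (≤-trans (advanceCost≤ 1 (s≤s (s≤s z≤n))) (*-monoʳ-≤ 5 (XQ-mono {3} {4} (n≤1+n 3)))))) ⟩
    X * (XQ 4 + (XQ 4 + 6 * XQ 4 + 5 * XQ 4)) ≡⟨ eq X Q ⟩
    13 * XQ 5 ∎
    where
    open ≤-Reasoning
    X≤ : X ≤ XQ 4
    X≤ = ≤-trans (≤-reflexive (sym (*-identityʳ X)))
      (≤-trans (m≤m*n (X * 1) Q) (XQ-mono {1} {4} (s≤s z≤n)))
    eq : ∀ x q → let y = x * (x * (x * (x * 1))) * q in
      x * (y + (y + 6 * y + 5 * y)) ≡ 13 * (x * (x * (x * (x * (x * 1)))) * q)
    eq = solve-∀

-- The 13 comes from `programCost≤`, the 2 inside the fifth power from N + 1 ≤ 2 N, and the 4 from M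
-- + 1 ≤ 2 M for positive M together with the factor 2 in `few-path-sets`.
C₀ : ℕ
C₀ = 4 * (13 * (2 * unit) ^ 5)

suc-^-≤ : ∀ b M Z → 1 ≤ Z → M ^ suc b ≤ 2 ^ suc b * Z → suc M ^ suc b ≤ 4 ^ suc b * Z
suc-^-≤ b zero    Z 1≤Z h = ≤-trans (≤-reflexive (^-zeroˡ (suc b))) (*-mono-≤ (m^n>0 4 (suc b)) 1≤Z)
suc-^-≤ b (suc M) Z 1≤Z h = begin
  suc (suc M) ^ suc b           ≤⟨ ^-monoˡ-≤ (suc b) (≤-trans (m≤m+n _ M) (≤-reflexive (eq M))) ⟩
  (2 * suc M) ^ suc b           ≡⟨ ^-distribʳ-* 2 (suc M) (suc b) ⟩
  2 ^ suc b * suc M ^ suc b     ≤⟨ *-monoʳ-≤ (2 ^ suc b) h ⟩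
  2 ^ suc b * (2 ^ suc b * Z)   ≡⟨ *-assoc (2 ^ suc b) (2 ^ suc b) Z ⟨
  2 ^ suc b * 2 ^ suc b * Z     ≡⟨ cong (_* Z) (^-distribʳ-* 2 2 (suc b)) ⟨
  4 ^ suc b * Z                 ∎
  where
  open ≤-Reasoning
  eq : ∀ m → suc (suc m) + m ≡ 2 * suc m
  eq = solve-∀

cancel-2^ : ∀ b M N B → M * 2 ^ N ≤ B * 2 ^ (suc b * N) → M ≤ B * 2 ^ (b * N)
cancel-2^ b M N B h = *-cancelʳ-≤ M (B * 2 ^ (b * N)) (2 ^ N) {{m^n≢0 2 N}} (begin
  M * 2 ^ N                   ≤⟨ h ⟩
  B * 2 ^ (N + b * N)         ≡⟨ cong (B *_) (^-distribˡ-+-* 2 N (b * N)) ⟩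
  B * (2 ^ N * 2 ^ (b * N))   ≡⟨ eq B (2 ^ N) (2 ^ (b * N)) ⟩
  B * 2 ^ (b * N) * 2 ^ N     ∎)
  where
  open ≤-Reasoning
  eq : ∀ a b c → a * (b * c) ≡ a * c * b
  eq = solve-∀

total-cost : ∀ b N M t → 1 ≤ N →
  M ^ suc b * 2 ^ N ≤ 2 ^ suc b * 2 ^ (suc b * N) →
  t ≤ 13 * ((suc N * unit) ^ 5 * suc M) →
  t ^ suc b ≤ (C₀ * N ^ 5) ^ suc b * 2 ^ (b * N)
total-cost b N M t 1≤N hM ht = begin
  t ^ suc b                                ≤⟨ ^-monoˡ-≤ (suc b) ht′ ⟩
  (P * suc M) ^ suc b                      ≡⟨ ^-distribʳ-* P (suc M) (suc b) ⟩
  P ^ suc b * suc M ^ suc b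
    ≤⟨ *-monoʳ-≤ (P ^ suc b)
         (suc-^-≤ b M Z (m^n>0 2 (b * N)) (cancel-2^ b (M ^ suc b) N (2 ^ suc b) hM)) ⟩
  P ^ suc b * (4 ^ suc b * Z)              ≡⟨ *-assoc (P ^ suc b) (4 ^ suc b) Z ⟨
  P ^ suc b * 4 ^ suc b * Z                ≡⟨ cong (_* Z) (^-distribʳ-* P 4 (suc b)) ⟨
  (P * 4) ^ suc b * Z
    ≡⟨ cong (λ z → z ^ suc b * Z) (eq ((2 * unit) ^ 5) (N ^ 5)) ⟩
  (C₀ * N ^ 5) ^ suc b * Z                 ∎
  where
  open ≤-Reasoning
  Z = 2 ^ (b * N)
  P = 13 * ((2 * unit) ^ 5 * N ^ 5)
  eq : ∀ x y → 13 * (x * y) * 4 ≡ 4 * (13 * x) * y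
  eq = solve-∀
  eq′ : ∀ n u → (n + n) * u ≡ 2 * u * n
  eq′ = solve-∀
  ht′ : t ≤ P * suc M
  ht′ = begin
    t                                     ≤⟨ ht ⟩
    13 * ((suc N * unit) ^ 5 * suc M)
      ≤⟨ *-monoʳ-≤ 13 (*-monoˡ-≤ (suc M) (^-monoˡ-≤ 5
           (≤-trans (*-monoˡ-≤ unit (+-monoˡ-≤ N 1≤N)) (≤-reflexive (eq′ N unit))))) ⟩
    13 * ((2 * unit * N) ^ 5 * suc M)
      ≡⟨ cong (λ z → 13 * (z * suc M)) (^-distribʳ-* (2 * unit) N 5) ⟩
    13 * ((2 * unit) ^ 5 * N ^ 5 * suc M) ≡⟨ *-assoc 13 ((2 * unit) ^ 5 * N ^ 5) (suc M) ⟨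
    P * suc M                             ∎

too-small : ∀ {n} {G : Graph n} {w : EdgeWeights G} → n < 3 → TSPAnswer G w nil
too-small n<3 = noCycle λ vs H → <⇒≱ n<3
  (≤-trans (HamiltonianCycle.length≥3 H) (≤-reflexive (hamiltonian-length H)))

unit≤ : ∀ N M → unit ≤ 13 * ((suc N * unit) ^ 5 * suc M)
unit≤ N M = begin
  unit                                ≤⟨ m≤m+n unit (N * unit) ⟩
  X                                   ≡⟨ *-identityʳ X ⟨
  X ^ 1
    ≤⟨ ^-monoʳ-≤ X {{>-nonZero (≤-trans (≤unit 1) (m≤m+n unit _))}} {1} {5} (s≤s z≤n) ⟩
  X ^ 5                               ≤⟨ m≤m*n (X ^ 5) (suc M) ⟩
  X ^ 5 * suc M                       ≤⟨ m≤n*m (X ^ 5 * suc M) 13 ⟩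
  13 * (X ^ 5 * suc M)                ∎
  where
  open ≤-Reasoning
  X = suc N * unit

program-correct : Decidable _≤ᴿ_ → ∀ n (G : Graph (suc n)) (w : EdgeWeights G) g →
  (∀ X vs → Unique vs → Linked (Adj G) vs → X ∋≡ vs → 1 ≤ g X) →
  ∃[ v ] (Within (encodeInstance G w ∷ []) program v
            (13 * ((suc (suc n) * unit) ^ 5 * suc (sumV g))) ×
          TSPAnswer G w v)
program-correct _≤?ᴿ_ 0 G w g good =
  nil , relax (unit≤ 1 (sumV g)) (program-1 w) , too-small (s≤s (s≤s z≤n))
program-correct _≤?ᴿ_ 1 G w g good =
  nil , relax (unit≤ 2 (sumV g)) (program-2 w) , too-small ≤-refl
program-correct _≤?ᴿ_ (suc (suc n)) G w g good =
  firstPath (answer _≤?ᴿ_ w)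
  , relax (programCost≤ _≤?ᴿ_ w (sumV g))
      (program-⇓ _≤?ᴿ_ w (suc ((3 + n) * sumV g))
        (length-layers _≤?ᴿ_ w g λ {i} {s} r →
          let open Path (reach-path _≤?ᴿ_ w r) in
          good (bits s) (vs s) unique (linked-init {G = G} (vs s) linked) visited))
  , closing-correct _≤?ᴿ_ w (s≤s (s≤s (s≤s z≤n)))

theorem1p1 : ∀ (d : ℝ) → 1ᴿ ≤ᴿ d →
    Σ[ ε ∈ ℝ ] (0ᴿ <ᴿ ε ×
    Σ[ A ∈ Program ] Σ[ C ∈ ℕ ] Σ[ k ∈ ℕ ] (Decidable _≤ᴿ_ →
    ∀ (n : ℕ) {{_ : NonZero n}} (G : Graph n) (w : EdgeWeights G) →
    fromℚ (averageDegree G) ≤ᴿ d →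
    Σ[ v ∈ Value ] Σ[ t ∈ ℕ ] ((encodeInstance G w ∷ []) ⊢ A ⇓ v [ t ] ×
    TSPAnswer G w v ×
    t ≤ (C * n ^ k) ·2^ (n ·ᴿ (1ᴿ -ᴿ ε)))))
theorem1p1 d _ = fromℚ ε , (ε , 0<ε , 0 , λ _ _ → ℚₚ.≤-reflexive (ℚₚ.+-identityˡ ε)) ,
  program , C₀ , 5 , λ where
    -- The constants and the program are already fixed at this point; `dec` enters only in
    -- exhibiting the run and its answer.
    dec (suc n) G w h →
      let g , good , few = few-path-sets (degreeBound d) G (degree-sum d n G h)
          v , within {t} run≤ t≤ , ans = program-correct dec n G w g good
      in v , t , run≤ , ans ,
         ≤·2^-intro b (1ᴿ -ᴿ fromℚ ε) (λ _ → 1-q b ε (toℚᵘ-/ 1 b)) (suc n) t (C₀ * suc n ^ 5)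
           (total-cost b (suc n) (sumV g) t (s≤s z≤n)
             (subst (λ e → sumV g ^ e * 2 ^ suc n ≤ 2 ^ e * 2 ^ (e * suc n)) exponent≡ few) t≤)
  where
  b : ℕ
  b = pred (exponent (degreeBound d))
  exponent≡ : exponent (degreeBound d) ≡ suc b
  exponent≡ = sym (suc-pred (exponent (degreeBound d)) {{exponent≢0 (degreeBound d)}})
  ε : ℚ
  ε = + 1 ℚ./ suc b
  0<ε : 0ℚ ℚ.< ε
  0<ε = ℚₚ.positive⁻¹ ε {{ℚₚ.normalize-pos 1 (suc b)}}
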